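{- Let $G=(V,E)$ be a simple finite graph on $m$ vertices $V=\{v_1,\ldots,v_m\}$ with degrees $d_j=\deg(v_j)$, and suppose that for some integer $d$ the graph has a unique vertex $v_r$ of degree $d$. Let $\Lambda=\Delta-\Psi$ be the zeon combinatorial Laplacian of $G$, and let $\lambda$ be the unique eigenvalue of $\Lambda$ satisfying $\mathfrak{C}\lambda=d$. Then $\Lambda$ has an eigenvector (associated with $\lambda$) of the form $x_\lambda=(\mu_1,\ldots,\mu_m)^\intercal$ where $\mu_r=1$ and $\mu_i\in\mathbb{C}\mathfrak{Z}_m^{\circ}$ for $i\neq r$. In particular, for each $\ell\neq r$, $$\langle\mu_\ell,\zeta_I\rangle=\gamma_I\,(d-d_\ell)^{ -1}\prod_{j\in I\setminus\{r\}}(d-d_j)^{ -1},$$ where $(-1)^{|I|}\gamma_I$ denotes the number of paths and PWICs $v_\ell\to v_r$ on vertices indexed by $I\subseteq\{1,\ldots,m\}$. Moreover, $$\lambda=d+\sum_{\{j:\{v_j,v_r\}\in E\}}\zeta_{\{j\}}\mu_j.$$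
   Context: Zeon algebra: $\mathbb{C}\mathfrak{Z}$ is the commutative unital complex algebra generated by $\zeta_{\{i\}}$, $i\in\mathbb{N}=\{1,2,\ldots\}$, and the scalar $1=\zeta_\varnothing$, with $\zeta_{\{i\}}\zeta_{\{j\}}=\zeta_{\{j\}}\zeta_{\{i\}}=\zeta_{\{i,j\}}$ for $i\neq j$ and $\zeta_{\{i\}}^2=0$. For finite $I\subset\mathbb{N}$, $\zeta_I=\prod_{i\in I}\zeta_{\{i\}}$; the $\zeta_I$ form a vector space basis. $\mathbb{C}\mathfrak{Z}_m$ is the subalgebra generated by $1,\zeta_{\{1\}},\ldots,\zeta_{\{m\}}$ and $\mathbb{C}\mathfrak{Z}_m^{\circ}$ is its ideal of nilpotent elements (those with zero scalar part). For $u=\sum_I u_I\zeta_I$, the scalar part is $\mathfrak{C}u=u_\varnothing$, and $\langle u,\zeta_I\rangle=u_I$ is the coefficient of $\zeta_I$. Eigenvalues: for $A\in\mathrm{Mat}(m,\mathbb{C}\mathfrak{Z})$ (the $m\times m$ matrices over $\mathbb{C}\mathfrak{Z}$), $\lambda\in\mathbb{C}\mathfrak{Z}$ is an eigenvalue with eigenvector $\xi$ if $A\xi=\lambda\xi$ with $\xi\in\mathbb{C}\mathfrak{Z}^m$ non-null ($\mathfrak{C}(\overline{\xi}^{\intercal}\xi)\ne 0$, where the bar is complex conjugation of coefficients; equivalently some component of $\xi$ has nonzero scalar part). Graphs: the nilpotent adjacency matrix $\Psi=(\psi_{ij})$ of $G$ has $\psi_{ij}=\zeta_{\{j\}}$ if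 $\{v_i,v_j\}\in E$ and $\psi_{ij}=0$ otherwise. $\Delta=\mathrm{diag}(d_1,\ldots,d_m)$. The zeon combinatorial Laplacian is $\Lambda=\Delta-\Psi$. Paths and PWICs: a walk from $v_\ell$ to $v_r$ is a sequence of vertices $(w_0,\ldots,w_k)$ with $w_0=v_\ell$, $w_k=v_r$ and consecutive vertices adjacent. A path is a walk with no repeated vertex. A PWIC (path with initial cycle) from $v_\ell$ to $v_r$ (distinct vertices) is a walk in which no vertex is repeated except the initial vertex $v_\ell$, which is repeated exactly once (i.e. occurs exactly twice, so the walk contains exactly one cycle, based at $v_\ell$). A path or PWIC $(w_0,\ldots,w_k)$ is on vertices indexed by $I$ when $\{w_1,\ldots,w_k\}=\{v_i:i\in I\}$, i.e. the initial occurrence $w_0$ is not included (so $\ell\notin I$ for a path and $\ell\in I$ for a PWIC).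
   Formalization: The closing formula is proved with a minus sign, λ = d − Σ ζ_{j} μ_j, instead of the printed plus, which is false: for the path v_1v_2v_3 with r = 2, d = 2, one has μ_1 = μ_3 = −ζ_{2} and λ = 2 + ζ_{1,2} + ζ_{2,3}. -}

module Defs where

open import Algebra.Bundles using (CommutativeRing)
open import Algebra.Bundles.Raw using (RawRing)
open import Algebra.Apartness.Bundles using (HeytingCommutativeRing; HeytingField)
import Algebra.Definitions.RawSemiring as RawSemiringDefs
open import Data.Bool.Base using (if_then_else_)
import Data.Bool.Properties as Bool
open import Data.Empty using (⊥-elim)
open import Data.Fin.Base using (Fin; zero; suc)
import Data.Fin.Properties as Fin
open import Data.Fin.Subset using (Subset; inside; outside; ⁅_⁆; ∣_∣; _∈_) renaming (⊥ to ∅)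
open import Data.Fin.Subset.Properties using (_∈?_)
open import Data.Integer.Base as ℤ using (ℤ; +_; -[1+_])
import Data.Integer.Properties as ℤ
open import Data.List.Base as List using (List)
import Data.List.Membership.Propositional as List
open import Data.List.Relation.Unary.Linked using (Linked)
open import Data.List.Relation.Unary.Unique.Propositional using (Unique)
open import Data.Maybe.Base as Maybe using (Maybe; just; nothing; maybe′)
open import Data.Nat.Base as ℕ using (ℕ; zero; suc)
open import Data.Product.Base using (∃; ∃-syntax; _×_; _,_; proj₁; proj₂)
open import Data.Sum.Base using (_⊎_; inj₁; inj₂)
open import Data.Vec.Base using ([]; _∷_; tabulate)
import Data.Vec.Properties as Vec
open import Function.Base using (_∘_)
open import Function.Bundles using (_⇔_; Equivalence)
open import Level using (Level; _⊔_; 0ℓ) renaming (suc to lsuc)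
open import Relation.Binary.Core using (Rel)
open import Relation.Binary.Definitions using (Decidable; Symmetric; Irreflexive)
open import Relation.Binary.PropositionalEquality.Core using (_≡_; _≢_; refl; sym)
open import Relation.Binary.Structures using (IsStrictPartialOrder)
open import Relation.Nullary.Decidable.Core using (Dec; yes; no; does)
open import Relation.Nullary.Negation.Core using (¬_)

-- The real numbers, as a Cauchy-complete Archimedean ordered field.  Over
-- classical logic these axioms determine ℝ up to isomorphism; constructively
-- the field axioms are those of a Heyting field, so that inverses exist for
-- elements apart from 0.

record RealNumbers c ℓ₁ ℓ₂ : Set (lsuc (c ⊔ ℓ₁ ⊔ ℓ₂)) where
  infix 4 _<_
  field
    heytingField : HeytingField c ℓ₁ ℓ₂

  open HeytingField heytingField public

  open HeytingCommutativeRing heytingCommutativeRing public using (commutativeRing)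
  open CommutativeRing commutativeRing public using (rawRing)

  open RawSemiringDefs (RawRing.rawSemiring rawRing) public
    using () renaming (_×_ to _·_)

  field
    _<_                  : Rel Carrier ℓ₂
    isStrictPartialOrder : IsStrictPartialOrder _≈_ _<_
    #⇔<⊎>                : ∀ {x y} → x # y ⇔ (x < y ⊎ y < x)
    0<1                  : 0# < 1#
    +-monoʳ-<            : ∀ z {x y} → x < y → z + x < z + y
    *-pos                : ∀ {x y} → 0# < x → 0# < y → 0# < x * y
    archimedean          : ∀ x → ∃[ n ] x < n · 1#

  IsCauchy : (ℕ → Carrier) → Set (c ⊔ ℓ₂)
  IsCauchy s = ∀ ε → 0# < ε → ∃[ N ] (∀ i j → N ℕ.≤ i → N ℕ.≤ j → s i - s j < ε)

  _ConvergesTo_ : (ℕ → Carrier) → Carrier → Set (c ⊔ ℓ₂)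
  s ConvergesTo x =
    ∀ ε → 0# < ε → ∃[ N ] (∀ i → N ℕ.≤ i → (s i - x < ε) × (x - s i < ε))

  field
    complete : ∀ s → IsCauchy s → ∃[ x ] (s ConvergesTo x)

module Integers {c ℓ₁ ℓ₂} (ℝ : RealNumbers c ℓ₁ ℓ₂) where
  open RealNumbers ℝ using
    ( Carrier; _≈_; _#_; _+_; -_; 0#; 1#; _·_; _<_; 0<1; +-monoʳ-<; #⇔<⊎>
    ; isStrictPartialOrder; #⇒invertible; +-identityʳ; -‿inverseˡ )
  open IsStrictPartialOrder isStrictPartialOrder using ()
    renaming (trans to <-trans; <-respʳ-≈ to <-respʳ; <-respˡ-≈ to <-respˡ)

  fromℤ : ℤ → Carrier
  fromℤ (+ n)    = n · 1#
  fromℤ -[1+ n ] = - (suc n · 1#)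

  0<suc : ∀ n → 0# < suc n · 1#
  0<suc zero    = <-respʳ (RealNumbers.sym ℝ (+-identityʳ 1#)) 0<1
  0<suc (suc n) =
    <-trans 0<1 (<-respˡ (+-identityʳ 1#) (+-monoʳ-< 1# (0<suc n)))

  fromℤ#0 : ∀ z → z ≢ + 0 → fromℤ z # 0#
  fromℤ#0 (+ zero)  z≢0 = ⊥-elim (z≢0 refl)
  fromℤ#0 (+ suc n) _   = Equivalence.from #⇔<⊎> (inj₂ (0<suc n))
  fromℤ#0 -[1+ n ]  _   = Equivalence.from #⇔<⊎> (inj₁
    (<-respʳ (-‿inverseˡ x) (<-respˡ (+-identityʳ (- x)) (+-monoʳ-< (- x) (0<suc n)))))
    where x = suc n · 1#

  -- The library's inverse is literally that of fromℤ z - 0#.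
  inverse : ∀ z → z ≢ + 0 → Carrier
  inverse z z≢0 = proj₁ (#⇒invertible (fromℤ#0 z z≢0))

module Complex {c ℓ₁ ℓ₂} (ℝ : RealNumbers c ℓ₁ ℓ₂) where
  private module ℝ = RealNumbers ℝ

  record ℂ : Set c where
    constructor _+i_
    field
      re im : ℝ.Carrier
  open ℂ public

  rawRing : RawRing c ℓ₁
  rawRing = record
    { Carrier = ℂ
    ; _≈_     = λ z w → (re z ℝ.≈ re w) × (im z ℝ.≈ im w)
    ; _+_     = λ z w → (re z ℝ.+ re w) +i (im z ℝ.+ im w)
    ; _*_     = λ z w → (re z ℝ.* re w ℝ.- im z ℝ.* im w) +i (re z ℝ.* im w ℝ.+ im z ℝ.* re w)
    ; -_      = λ z → (ℝ.- re z) +i (ℝ.- im z)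
    ; 0#      = ℝ.0# +i ℝ.0#
    ; 1#      = ℝ.1# +i ℝ.0#
    }

  open RawRing rawRing public using ()
    renaming (_≈_ to infix 4 _≈ℂ_; _*_ to infixl 7 _*ℂ_; 0# to 0ℂ; 1# to 1ℂ)
  open RawSemiringDefs (RawRing.rawSemiring rawRing) public
    using () renaming (product to productℂ)

  _#_ : Rel ℂ ℓ₂
  z # w = (re z ℝ.# re w) ⊎ (im z ℝ.# im w)

  conj : ℂ → ℂ
  conj z = re z +i (ℝ.- im z)

  fromℝ : ℝ.Carrier → ℂ
  fromℝ x = x +i ℝ.0#

  ⟦_⟧ : ℤ → ℂ
  ⟦ z ⟧ = fromℝ (Integers.fromℤ ℝ z)

  _⁻¹⟨_⟩ : ∀ z → z ≢ + 0 → ℂ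
  z ⁻¹⟨ z≢0 ⟩ = fromℝ (Integers.inverse ℝ z z≢0)

-- Multi-indices are finite sets of positive integers, encoded as subsets of
-- {1,…,n} for some n, with zero : Fin n standing for 1.  The same set has an
-- encoding for every sufficiently large n; restrict n I is the encoding of I
-- as a subset of {1,…,n}, if I is contained in {1,…,n}.

restrict : ∀ {k} n → Subset k → Maybe (Subset n)
restrict n       []            = just ∅
restrict zero    (outside ∷ I) = restrict zero I
restrict zero    (inside ∷ I)  = nothing
restrict (suc n) (s ∷ I)       = Maybe.map (s ∷_) (restrict n I)

module ZeonAlgebra {c ℓ} (K : RawRing c ℓ) where
  private module K = RawRing K

  -- The finite linear combination Σ_I coeffs I · ζ_I over I ⊆ {1,…,bound}.
  record Zeon : Set c where
    constructor zeon
    field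
      bound  : ℕ
      coeffs : Subset bound → K.Carrier

  ⟨_,ζ_⟩ : ∀ {n} → Zeon → Subset n → K.Carrier
  ⟨ zeon b f ,ζ I ⟩ = maybe′ f K.0# (restrict b I)

  𝔠 : Zeon → K.Carrier
  𝔠 u = ⟨ u ,ζ [] ⟩

  ζ : ∀ {n} → Subset n → Zeon
  ζ {n} I = zeon n λ J → if does (Vec.≡-dec Bool._≟_ J I) then K.1# else K.0#

  scalar : K.Carrier → Zeon
  scalar a = zeon 0 λ _ → a

  -- conv f g I = Σ_{J ⊆ I} f J · g (I ∖ J), since ζ_J ζ_L = ζ_{J ∪ L} if J and L
  -- are disjoint and ζ_J ζ_L = 0 otherwise.
  conv : ∀ {n} → (Subset n → K.Carrier) → (Subset n → K.Carrier) → Subset n → K.Carrier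
  conv f g []            = f [] K.* g []
  conv f g (outside ∷ I) = conv (f ∘ (outside ∷_)) (g ∘ (outside ∷_)) I
  conv f g (inside ∷ I)  = conv (f ∘ (inside ∷_)) (g ∘ (outside ∷_)) I
                     K.+ conv (f ∘ (outside ∷_)) (g ∘ (inside ∷_)) I

  rawRing : RawRing c ℓ
  rawRing = record
    { Carrier = Zeon
    ; _≈_     = λ u v → ∀ {n} (I : Subset n) → ⟨ u ,ζ I ⟩ K.≈ ⟨ v ,ζ I ⟩
    ; _+_     = λ u v → zeon (Zeon.bound u ℕ.⊔ Zeon.bound v) λ I → ⟨ u ,ζ I ⟩ K.+ ⟨ v ,ζ I ⟩
    ; _*_     = λ u v → zeon (Zeon.bound u ℕ.⊔ Zeon.bound v) (conv ⟨ u ,ζ_⟩ ⟨ v ,ζ_⟩)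
    ; -_      = λ u → zeon (Zeon.bound u) (K.-_ ∘ Zeon.coeffs u)
    ; 0#      = scalar K.0#
    ; 1#      = scalar K.1#
    }

  open RawRing rawRing public using (_≈_; _+_; _*_; -_; 0#; 1#)
  open RawSemiringDefs (RawRing.rawSemiring rawRing) public using (sum; _^_)

  infixl 6 _-_
  _-_ : Zeon → Zeon → Zeon
  u - v = u + (- v)

  data InSubalgebra (m : ℕ) : Zeon → Set (c ⊔ ℓ) where
    scalar∈ : ∀ a → InSubalgebra m (scalar a)
    ζ∈      : ∀ (i : Fin m) → InSubalgebra m (ζ ⁅ i ⁆)
    +∈      : ∀ {u v} → InSubalgebra m u → InSubalgebra m v → InSubalgebra m (u + v)
    *∈      : ∀ {u v} → InSubalgebra m u → InSubalgebra m v → InSubalgebra m (u * v)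
    ≈∈      : ∀ {u v} → u ≈ v → InSubalgebra m u → InSubalgebra m v

  InNilpotentIdeal : ℕ → Zeon → Set (c ⊔ ℓ)
  InNilpotentIdeal m u = InSubalgebra m u × (∃[ k ] u ^ k ≈ 0#)

module ZeonMatrices {c ℓ₁ ℓ₂} (ℝ : RealNumbers c ℓ₁ ℓ₂) where
  open Complex ℝ using (conj; _#_; 0ℂ)
  open ZeonAlgebra (Complex.rawRing ℝ) public

  Matrix : ℕ → Set c
  Matrix m = Fin m → Fin m → Zeon

  conjugate : Zeon → Zeon
  conjugate (zeon b f) = zeon b (conj ∘ f)

  NonNull : ∀ {m} → (Fin m → Zeon) → Set ℓ₂
  NonNull ξ = 𝔠 (sum λ i → conjugate (ξ i) * ξ i) # 0ℂ

  IsEigenvector : ∀ {m} → Matrix m → Zeon → (Fin m → Zeon) → Set (ℓ₁ ⊔ ℓ₂)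
  IsEigenvector A ev ξ = NonNull ξ × (∀ i → sum (λ j → A i j * ξ j) ≈ ev * ξ i)

  IsEigenvalue : ∀ {m} → Matrix m → Zeon → Set (c ⊔ ℓ₁ ⊔ ℓ₂)
  IsEigenvalue A ev = ∃ (IsEigenvector A ev)

record SimpleGraph (m : ℕ) : Set₁ where
  field
    Adj    : Rel (Fin m) 0ℓ
    adj?   : Decidable Adj
    symm   : Symmetric Adj
    irrefl : Irreflexive _≡_ Adj

  deg : Fin m → ℕ
  deg i = ∣ tabulate (λ j → does (adj? i j)) ∣

  UniqueVertexOfDegree : ℤ → Fin m → Set
  UniqueVertexOfDegree d r = (+ deg r ≡ d) × (∀ j → + deg j ≡ d → j ≡ r)

  IsWalk : Fin m → Fin m → List (Fin m) → Set
  IsWalk l r w = (List.head w ≡ just l) × (List.last w ≡ just r) × Linked Adj w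

  IsPath : Fin m → Fin m → List (Fin m) → Set
  IsPath l r w = IsWalk l r w × Unique w

  occurrences : Fin m → List (Fin m) → ℕ
  occurrences v w = List.length (List.filter (v Fin.≟_) w)

  IsPWIC : Fin m → Fin m → List (Fin m) → Set
  IsPWIC l r w = l ≢ r × IsWalk l r w × occurrences l w ≡ 2
               × (∀ v → v ≢ l → occurrences v w ℕ.≤ 1)

  -- The initial entry of the walk is not counted.
  OnVertices : Subset m → List (Fin m) → Set
  OnVertices I w = ∀ i → i ∈ I ⇔ (i List.∈ List.drop 1 w)

  PathOrPWICOn : Fin m → Fin m → Subset m → List (Fin m) → Set
  PathOrPWICOn l r I w = (IsPath l r w ⊎ IsPWIC l r w) × OnVertices I w

HasExactly : ∀ {a p} {A : Set a} → ℕ → (A → Set p) → Set (a ⊔ p)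
HasExactly n P = ∃[ xs ] Unique xs × (∀ x → x List.∈ xs ⇔ P x) × List.length xs ≡ n

module ZeonLaplacian {c ℓ₁ ℓ₂} (ℝ : RealNumbers c ℓ₁ ℓ₂) {m} (G : SimpleGraph m) where
  open SimpleGraph G
  open Complex ℝ using (ℂ; 1ℂ; productℂ; ⟦_⟧; _⁻¹⟨_⟩)
  open ZeonMatrices ℝ

  Ψ : Matrix m
  Ψ i j = if does (adj? i j) then ζ ⁅ j ⁆ else 0#

  Δ : Matrix m
  Δ i j = if does (i Fin.≟ j) then scalar ⟦ + deg i ⟧ else 0#

  Λ : Matrix m
  Λ i j = Δ i j - Ψ i j

  module _ {d : ℤ} {r : Fin m} (r-unique : UniqueVertexOfDegree d r) where

    gap≢0 : ∀ j → j ≢ r → d ℤ.- + deg j ≢ + 0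
    gap≢0 j j≢r eq = j≢r (proj₂ r-unique j (sym (ℤ.i-j≡0⇒i≡j d (+ deg j) eq)))

    gap⁻¹ : ∀ j → j ≢ r → ℂ
    gap⁻¹ j j≢r = (d ℤ.- + deg j) ⁻¹⟨ gap≢0 j j≢r ⟩

    gap⁻¹-product : Subset m → ℂ
    gap⁻¹-product I = productℂ λ j → factor j (j ∈? I) (j Fin.≟ r)
      where
      factor : ∀ j → Dec (j ∈ I) → Dec (j ≡ r) → ℂ
      factor j (yes _) (no j≢r) = gap⁻¹ j j≢r
      factor _ _       _        = 1ℂ

{-# OPTIONS --safe #-}

-- For l ≠ r define the coefficients of μ_l by the claimed formula, the number of paths
-- and PWICs being that of an explicit list of walks.  Removing the first step of such a
-- walk gives (d - d_l) μ_l = - (Ψ μ)_l.  Every such walk visits r after its start, so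
-- each μ_l with l ≠ r, and therefore also (Ψ μ)_r, is a multiple of ζ_r; hence
-- (Ψ μ)_r μ_l = 0, and μ is an eigenvector for d - (Ψ μ)_r.
--
-- Conversely let ξ be an eigenvector for an eigenvalue λ with scalar part d.  The entries
-- of η = ξ - ξ_r μ satisfy
--   (d_l - λ) η_l = (Ψ η)_l - (Ψ η)_r μ_l,   η_r = 0,
-- where d_l - λ is invertible for l ≠ r and Ψ raises degrees.  So η vanishes in every
-- degree, hence 𝔠 ξ_r is invertible because ξ is non-null, and row r gives
-- ξ_r (d - (Ψ μ)_r - λ) = 0.

module Submission where

open import Defs
open import Algebra.Bundles using (CommutativeMonoid; CommutativeRing)
open import Algebra.Bundles.Raw using (RawRing)
import Algebra.Properties.AbelianGroup
import Algebra.Properties.CommutativeMonoid.Sum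
import Algebra.Properties.CommutativeSemigroup
import Algebra.Properties.Monoid.Mult
import Algebra.Properties.Ring
import Algebra.Properties.Semiring.Mult
import Algebra.Properties.Semiring.Sum
import Algebra.Solver.Ring.NaturalCoefficients.Default
open import Data.Bool.Base using (true; false; if_then_else_)
import Data.Bool.Properties as Bool
open import Data.Fin.Base using (Fin; zero; suc)
import Data.Fin.Properties as Fin
open import Data.Fin.Subset using (Subset; inside; outside; ⁅_⁆; ∣_∣; _∈_; _∉_; _─_)
  renaming (⊥ to ∅; _-_ to _∖_)
open import Data.Fin.Subset.Properties
  using (_∈?_; ∉⊥; ∣⊥∣≡0; Empty-unique; x∈p∧x≢y⇒x∈p-y; p─⊥≡p; p─q⊆p)
open import Data.Integer.Base using (ℤ; +_; -[1+_]; -1ℤ; _⊖_)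
import Data.Integer.Base as ℤ
import Data.Integer.Properties as ℤ
open import Data.List.Base as List using (List; []; _∷_; length; map; concat; tabulate)
import Data.List.Membership.Propositional as List
open import Data.List.Membership.Propositional.Properties
  using (∈-concat⁺′; ∈-concat⁻′; ∈-tabulate⁺; ∈-tabulate⁻; ∈-map⁺; ∈-map⁻)
open import Data.List.Properties
  using (filter-accept; filter-reject; filter-none; filter-some; length-++; length-map; ∷-injectiveʳ)
import Data.List.Relation.Unary.All as All
import Data.List.Relation.Unary.All.Properties as All
open import Data.List.Relation.Unary.AllPairs using ([]; _∷_)
import Data.List.Relation.Unary.AllPairs.Properties as AllPairs
open import Data.List.Relation.Unary.Any using (here; there)
open import Data.List.Relation.Unary.Linked using (Linked; [-]; _∷_)
open import Data.List.Relation.Unary.Unique.Propositional using (Unique)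
import Data.List.Relation.Unary.Unique.Propositional.Properties as Unique
open import Data.Maybe.Base as Maybe using (just; nothing; maybe′)
open import Data.Maybe.Properties using (just-injective)
open import Data.Nat.Base as ℕ using (ℕ; zero; suc; z≤n; s≤s)
import Data.Nat.Properties as ℕ
open import Data.Product using (_×_; _,_; proj₁; proj₂; Σ-syntax; ∃-syntax; ∃!)
open import Data.Sum.Base using (_⊎_; inj₁; inj₂)
open import Data.Vec.Base using ([]; _∷_; here; there)
import Data.Vec.Properties as Vec
open import Function.Base using (_∘_)
open import Function.Bundles using (_⇔_; mk⇔; Equivalence)
open import Relation.Binary.PropositionalEquality as ≡ using (_≡_; _≢_)
import Relation.Binary.Reasoning.Setoid
open import Relation.Nullary.Decidable using (Dec; yes; no; does; _×-dec_; dec-true; dec-false)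
open import Relation.Nullary.Negation using (contradiction)

-- `Ψ i j` carries the generator of the vertex entered, never that of the vertex left. A product
-- along a walk thus records every vertex but the start, and ζ_j² = 0 forbids only a second entry.
-- The start may be entered once, which is why PWICs are counted beside paths, and each step
-- contributes one minus sign, whence (-1)^|I|.
--
-- Only two facts about the weights are needed: a vertex other than `r` contributes its inverse gap,
-- and `r` contributes nothing. The spectral argument therefore runs over any commutative ring, with
-- complex numbers entering through the actual gaps and through non-nullity, an apartness from which
-- an inverse has to be extracted.
--
-- Two points shape the algebra. A zeon stores coefficients at its own bound, whereas equality tests
-- index sets of every size, so products must be shown independent of the encoding. And no inverse
-- of a zeon is ever built: if `𝔠 u` is invertible, the lowest-degree part of a product `u * v`
-- determines that of `v`, which is enough for cancellation.

-- Re-encoding index sets.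

restrict-∅ : ∀ a b → restrict a (∅ {b}) ≡ just ∅
restrict-∅ a       zero    = ≡.refl
restrict-∅ zero    (suc b) = restrict-∅ zero b
restrict-∅ (suc a) (suc b) = ≡.cong (Maybe.map (outside ∷_)) (restrict-∅ a b)

restrict-self : ∀ {n} (I : Subset n) → restrict n I ≡ just I
restrict-self []      = ≡.refl
restrict-self (s ∷ I) = ≡.cong (Maybe.map (s ∷_)) (restrict-self I)

-- Passing through a larger bound loses nothing: an index set that does not fit below `b` does not
-- fit below `a` either. This lets coefficients be compared at a common bound.
restrict-restrict : ∀ {a b n} → a ℕ.≤ b → (I : Subset n) →
                    maybe′ (restrict a) nothing (restrict b I) ≡ restrict a I
restrict-restrict {a}     {b}     _   []            = restrict-∅ a b
restrict-restrict {zero}  {zero}  a≤b (outside ∷ I) = restrict-restrict a≤b I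
restrict-restrict {zero}  {zero}  _   (inside ∷ I)  = ≡.refl
restrict-restrict {zero}  {suc b} _   (outside ∷ I)
  with restrict b I | restrict-restrict {zero} {b} z≤n I
... | just _  | eq = eq
... | nothing | eq = eq
restrict-restrict {zero}  {suc b} _   (inside ∷ I) with restrict b I
... | just _  = ≡.refl
... | nothing = ≡.refl
restrict-restrict {suc a} {suc b} (s≤s a≤b) (s ∷ I)
  with restrict b I | restrict-restrict a≤b I
... | just _  | eq = ≡.cong (Maybe.map (s ∷_)) eq
... | nothing | eq = ≡.cong (Maybe.map (s ∷_)) eq

-- The zeon algebra over a commutative ring.

module ZeonRing {c ℓ} (K : CommutativeRing c ℓ) where
  private
    module K where
      open CommutativeRing K public
      open Algebra.Properties.CommutativeSemigroup +-commutativeSemigroup public using (interchange)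
      open Algebra.Properties.Ring ring public
      open Algebra.Properties.Semiring.Sum semiring public using (sum)
      open Relation.Binary.Reasoning.Setoid setoid public

  open ZeonAlgebra K.rawRing
  open K using (Carrier)

  private
    variable
      n : ℕ

  conv-cong : ∀ {f f′ g g′ : Subset n → Carrier} → (∀ I → f I K.≈ f′ I) → (∀ I → g I K.≈ g′ I) →
              ∀ I → conv f g I K.≈ conv f′ g′ I
  conv-cong f≈ g≈ []            = K.*-cong (f≈ []) (g≈ [])
  conv-cong f≈ g≈ (outside ∷ I) = conv-cong (f≈ ∘ (outside ∷_)) (g≈ ∘ (outside ∷_)) I
  conv-cong f≈ g≈ (inside ∷ I)  = K.+-cong
    (conv-cong (f≈ ∘ (inside ∷_)) (g≈ ∘ (outside ∷_)) I)
    (conv-cong (f≈ ∘ (outside ∷_)) (g≈ ∘ (inside ∷_)) I)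

  conv-comm : ∀ (f g : Subset n → Carrier) I → conv f g I K.≈ conv g f I
  conv-comm f g []            = K.*-comm (f []) (g [])
  conv-comm f g (outside ∷ I) = conv-comm _ _ I
  conv-comm f g (inside ∷ I)  =
    K.trans (K.+-cong (conv-comm _ _ I) (conv-comm _ _ I)) (K.+-comm _ _)

  conv-distribˡ : ∀ (f g h : Subset n → Carrier) I →
                  conv f (λ J → g J K.+ h J) I K.≈ conv f g I K.+ conv f h I
  conv-distribˡ f g h []            = K.distribˡ (f []) (g []) (h [])
  conv-distribˡ f g h (outside ∷ I) = conv-distribˡ _ _ _ I
  conv-distribˡ f g h (inside ∷ I)  = K.trans
    (K.+-cong (conv-distribˡ _ _ _ I) (conv-distribˡ _ _ _ I)) (K.interchange _ _ _ _)

  conv-distribʳ : ∀ (f g h : Subset n → Carrier) I →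
                  conv (λ J → g J K.+ h J) f I K.≈ conv g f I K.+ conv h f I
  conv-distribʳ f g h I = K.trans (conv-comm _ f I) (K.trans (conv-distribˡ f g h I)
    (K.+-cong (conv-comm f g I) (conv-comm f h I)))

  -- Splitting off the first generator ζ writes a family as f₀ + ζ f₁ with ζ² = 0. The `inside` case
  -- compares the ζ-coefficients of both triple products, in which exactly one factor supplies ζ.
  conv-assoc : ∀ (f g h : Subset n → Carrier) I → conv (conv f g) h I K.≈ conv f (conv g h) I
  conv-assoc f g h []            = K.*-assoc (f []) (g []) (h [])
  conv-assoc f g h (outside ∷ I) = conv-assoc _ _ _ I
  conv-assoc f g h (inside ∷ I)  = K.begin
    conv (conv f g ∘ (inside ∷_)) h₀ I K.+ conv (conv f₀ g₀) h₁ I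
      K.≈⟨ K.+-congʳ (conv-distribʳ h₀ (conv f₁ g₀) (conv f₀ g₁) I) ⟩
    (conv (conv f₁ g₀) h₀ I K.+ conv (conv f₀ g₁) h₀ I) K.+ conv (conv f₀ g₀) h₁ I
      K.≈⟨ K.+-assoc _ _ _ ⟩
    conv (conv f₁ g₀) h₀ I K.+ (conv (conv f₀ g₁) h₀ I K.+ conv (conv f₀ g₀) h₁ I)
      K.≈⟨ K.+-cong (conv-assoc f₁ g₀ h₀ I) (K.+-cong (conv-assoc f₀ g₁ h₀ I) (conv-assoc f₀ g₀ h₁ I)) ⟩
    conv f₁ (conv g₀ h₀) I K.+ (conv f₀ (conv g₁ h₀) I K.+ conv f₀ (conv g₀ h₁) I)
      K.≈⟨ K.+-congˡ (conv-distribˡ f₀ (conv g₁ h₀) (conv g₀ h₁) I) ⟨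
    conv f₁ (conv g₀ h₀) I K.+ conv f₀ (conv g h ∘ (inside ∷_)) I
      K.∎
    where
    f₀ = f ∘ (outside ∷_)
    f₁ = f ∘ (inside ∷_)
    g₀ = g ∘ (outside ∷_)
    g₁ = g ∘ (inside ∷_)
    h₀ = h ∘ (outside ∷_)
    h₁ = h ∘ (inside ∷_)

  conv-zeroˡ : ∀ {f : Subset n → Carrier} g → (∀ I → f I K.≈ K.0#) → ∀ I → conv f g I K.≈ K.0#
  conv-zeroˡ g f≈0 []            = K.trans (K.*-congʳ (f≈0 [])) (K.zeroˡ (g []))
  conv-zeroˡ g f≈0 (outside ∷ I) = conv-zeroˡ _ (f≈0 ∘ (outside ∷_)) I
  conv-zeroˡ g f≈0 (inside ∷ I)  = K.trans
    (K.+-cong (conv-zeroˡ _ (f≈0 ∘ (inside ∷_)) I) (conv-zeroˡ _ (f≈0 ∘ (outside ∷_)) I))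
    (K.+-identityˡ K.0#)

  conv-zeroʳ : ∀ f {g : Subset n → Carrier} → (∀ I → g I K.≈ K.0#) → ∀ I → conv f g I K.≈ K.0#
  conv-zeroʳ f g≈0 I = K.trans (conv-comm f _ I) (conv-zeroˡ f g≈0 I)

  conv-scalar : ∀ a (g : Subset n → Carrier) I → conv ⟨ scalar a ,ζ_⟩ g I K.≈ a K.* g I
  conv-scalar a g []            = K.refl
  conv-scalar a g (outside ∷ I) = conv-scalar a _ I
  conv-scalar a g (inside ∷ I)  = K.trans
    (K.+-cong (conv-zeroˡ _ (λ _ → K.refl) I) (conv-scalar a _ I)) (K.+-identityˡ _)

  conv-∅ : ∀ n (f g : Subset n → Carrier) → conv f g ∅ ≡ f ∅ K.* g ∅
  conv-∅ zero    f g = ≡.refl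
  conv-∅ (suc n) f g = conv-∅ n _ _

  -- The product has no other term in degree k when g vanishes below degree k.
  conv-lowest : ∀ {k} (f g : Subset n → Carrier) → (∀ I → ∣ I ∣ ℕ.< k → g I K.≈ K.0#) →
                ∀ I → ∣ I ∣ ℕ.≤ k → conv f g I K.≈ f ∅ K.* g I
  conv-lowest f g g≈0 []            _ = K.refl
  conv-lowest f g g≈0 (outside ∷ I) ∣I∣≤k = conv-lowest _ _ (g≈0 ∘ (outside ∷_)) I ∣I∣≤k
  conv-lowest f g g≈0 (inside ∷ I) (s≤s ∣I∣≤k) = K.begin
    conv f₁ g₀ I K.+ conv f₀ g₁ I
      K.≈⟨ K.+-cong (conv-lowest f₁ g₀ (g≈0 ∘ (outside ∷_)) I (ℕ.m≤n⇒m≤1+n ∣I∣≤k))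
                    (conv-lowest f₀ g₁ (λ J → g≈0 (inside ∷ J) ∘ s≤s) I ∣I∣≤k) ⟩
    f₁ ∅ K.* g₀ I K.+ f₀ ∅ K.* g₁ I
      K.≈⟨ K.+-congʳ (K.trans (K.*-congˡ (g≈0 (outside ∷ I) (s≤s ∣I∣≤k))) (K.zeroʳ _)) ⟩
    K.0# K.+ f₀ ∅ K.* g₁ I
      K.≈⟨ K.+-identityˡ _ ⟩
    f₀ ∅ K.* g₁ I
      K.∎
    where
    f₀ = f ∘ (outside ∷_)
    f₁ = f ∘ (inside ∷_)
    g₀ = g ∘ (outside ∷_)
    g₁ = g ∘ (inside ∷_)

  -- The product vanishes because ζ_r² = 0.
  conv-multiples : ∀ (r : Fin n) {f g : Subset n → Carrier} →
                   (∀ I → r ∉ I → f I K.≈ K.0#) → (∀ I → r ∉ I → g I K.≈ K.0#) →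
                   ∀ I → conv f g I K.≈ K.0#
  conv-multiples zero f≈0 g≈0 (outside ∷ I) = conv-zeroˡ _ (λ J → f≈0 (outside ∷ J) λ ()) I
  conv-multiples zero f≈0 g≈0 (inside ∷ I)  = K.trans
    (K.+-cong (conv-zeroʳ _ (λ J → g≈0 (outside ∷ J) λ ()) I)
              (conv-zeroˡ _ (λ J → f≈0 (outside ∷ J) λ ()) I))
    (K.+-identityˡ K.0#)
  conv-multiples (suc r) f≈0 g≈0 (outside ∷ I) =
    conv-multiples r (λ J r∉J → f≈0 (outside ∷ J) λ { (there r∈J) → r∉J r∈J })
                     (λ J r∉J → g≈0 (outside ∷ J) λ { (there r∈J) → r∉J r∈J }) I
  conv-multiples (suc r) f≈0 g≈0 (inside ∷ I)  = K.trans
    (K.+-cong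
      (conv-multiples r (λ J r∉J → f≈0 (inside ∷ J) λ { (there r∈J) → r∉J r∈J })
                        (λ J r∉J → g≈0 (outside ∷ J) λ { (there r∈J) → r∉J r∈J }) I)
      (conv-multiples r (λ J r∉J → f≈0 (outside ∷ J) λ { (there r∈J) → r∉J r∈J })
                        (λ J r∉J → g≈0 (inside ∷ J) λ { (there r∈J) → r∉J r∈J }) I))
    (K.+-identityˡ K.0#)

  indicator : Subset n → Subset n → Carrier
  indicator S J = if does (Vec.≡-dec Bool._≟_ J S) then K.1# else K.0#

  conv-indicator-∅ : ∀ (g : Subset n → Carrier) I → conv (indicator ∅) g I K.≈ g I
  conv-indicator-∅ g []            = K.*-identityˡ (g [])
  conv-indicator-∅ g (outside ∷ I) = conv-indicator-∅ _ I
  conv-indicator-∅ g (inside ∷ I)  = K.trans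
    (K.+-cong (conv-zeroˡ _ (λ _ → K.refl) I) (conv-indicator-∅ _ I)) (K.+-identityˡ _)

  conv-indicator-∈ : ∀ {j : Fin n} g {I} → j ∈ I → conv (indicator ⁅ j ⁆) g I K.≈ g (I ∖ j)
  conv-indicator-∈ {j = zero} g {inside ∷ I} here = K.begin
    conv (indicator ∅) (g ∘ (outside ∷_)) I K.+ conv (λ _ → K.0#) (g ∘ (inside ∷_)) I
      K.≈⟨ K.+-cong (conv-indicator-∅ _ I) (conv-zeroˡ _ (λ _ → K.refl) I) ⟩
    g (outside ∷ I) K.+ K.0#
      K.≈⟨ K.+-identityʳ _ ⟩
    g (outside ∷ I)
      -- Deleting `zero` unfolds to `outside ∷ (I ─ ∅)`, and `I ─ ∅` is not definitionally `I`.
      K.≡⟨ ≡.cong (g ∘ (outside ∷_)) (p─⊥≡p I) ⟨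
    g ((inside ∷ I) ∖ zero)
      K.∎
  conv-indicator-∈ {j = suc j} g {outside ∷ I} (there j∈I) = conv-indicator-∈ _ j∈I
  conv-indicator-∈ {j = suc j} g {inside ∷ I}  (there j∈I) = K.trans
    (K.+-cong (conv-zeroˡ _ (λ _ → K.refl) I) (conv-indicator-∈ _ j∈I)) (K.+-identityˡ _)

  conv-indicator-∉ : ∀ {j : Fin n} g {I} → j ∉ I → conv (indicator ⁅ j ⁆) g I K.≈ K.0#
  conv-indicator-∉ {j = zero}  g {outside ∷ I} _   = conv-zeroˡ _ (λ _ → K.refl) I
  conv-indicator-∉ {j = zero}  g {inside ∷ I}  j∉I = contradiction here j∉I
  conv-indicator-∉ {j = suc j} g {outside ∷ I} j∉I = conv-indicator-∉ _ (j∉I ∘ there)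
  conv-indicator-∉ {j = suc j} g {inside ∷ I}  j∉I = K.trans
    (K.+-cong (conv-zeroˡ _ (λ _ → K.refl) I) (conv-indicator-∉ _ (j∉I ∘ there))) (K.+-identityˡ _)

  -- A coefficient family is bounded by b if it is that of a zeon with bound b.
  Bounded : ℕ → (∀ {n} → Subset n → Carrier) → Set ℓ
  Bounded b f = ∀ {n} (I : Subset n) → f I K.≈ maybe′ f K.0# (restrict b I)

  Bounded-∷ : ∀ {b} s (f : ∀ {n} → Subset n → Carrier) → Bounded (suc b) f → Bounded b (λ I → f (s ∷ I))
  Bounded-∷ {b} s f f-bounded I with restrict b I | f-bounded (s ∷ I)
  ... | just _  | eq = eq
  ... | nothing | eq = eq

  -- At bound 0, `restrict` discards a leading `outside` without lowering the bound. The values at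
  -- `[]` and `outside ∷ []`, two encodings of the empty set, therefore have to be identified
  -- through the boundedness of `f`.
  Bounded-outside : ∀ (f : ∀ {n} → Subset n → Carrier) → Bounded 0 f → Bounded 0 (λ I → f (outside ∷ I))
  Bounded-outside f f-bounded I with restrict 0 I | f-bounded (outside ∷ I)
  ... | just [] | eq = K.trans eq (K.sym (f-bounded (outside ∷ [])))
  ... | nothing | eq = eq

  -- A product stores its convolution at one bound, but its coefficients are read at all sizes. An
  -- index beyond the bound must fall into one of the two factors, whose coefficient there is zero.
  conv-bounded : ∀ b (f g : ∀ {n} → Subset n → Carrier) → Bounded b f → Bounded b g →
                 Bounded b (λ I → conv f g I)
  conv-bounded b f g f-bounded g-bounded [] =
    K.trans (K.*-cong (f-bounded []) (g-bounded [])) (K.reflexive (≡.sym (conv-∅ b f g)))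
  conv-bounded zero f g f-bounded g-bounded (outside ∷ I)
    with restrict 0 I
       | conv-bounded 0 (λ J → f (outside ∷ J)) (λ J → g (outside ∷ J))
                        (Bounded-outside f f-bounded) (Bounded-outside g g-bounded) I
  ... | just [] | eq = K.trans eq (K.*-cong (f-bounded (outside ∷ [])) (g-bounded (outside ∷ [])))
  ... | nothing | eq = eq
  conv-bounded zero f g f-bounded g-bounded (inside ∷ I) = K.trans
    (K.+-cong (conv-zeroˡ _ (λ J → f-bounded (inside ∷ J)) I)
              (conv-zeroʳ _ (λ J → g-bounded (inside ∷ J)) I))
    (K.+-identityˡ K.0#)
  conv-bounded (suc b) f g f-bounded g-bounded (outside ∷ I)
    with restrict b I
       | conv-bounded b (λ J → f (outside ∷ J)) (λ J → g (outside ∷ J))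
                        (Bounded-∷ outside f f-bounded) (Bounded-∷ outside g g-bounded) I
  ... | just _  | eq = eq
  ... | nothing | eq = eq
  conv-bounded (suc b) f g f-bounded g-bounded (inside ∷ I)
    with restrict b I
       | conv-bounded b (λ J → f (inside ∷ J)) (λ J → g (outside ∷ J))
                        (Bounded-∷ inside f f-bounded) (Bounded-∷ outside g g-bounded) I
       | conv-bounded b (λ J → f (outside ∷ J)) (λ J → g (inside ∷ J))
                        (Bounded-∷ outside f f-bounded) (Bounded-∷ inside g g-bounded) I
  ... | just _  | eq₁ | eq₂ = K.+-cong eq₁ eq₂
  ... | nothing | eq₁ | eq₂ = K.trans (K.+-cong eq₁ eq₂) (K.+-identityˡ K.0#)

  coeff-bounded : ∀ {b} u → Zeon.bound u ℕ.≤ b → Bounded b ⟨ u ,ζ_⟩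
  coeff-bounded {b} (zeon a f) a≤b I with restrict b I | restrict-restrict a≤b I
  ... | just _  | eq = K.reflexive (≡.cong (maybe′ f K.0#) (≡.sym eq))
  ... | nothing | eq = K.reflexive (≡.cong (maybe′ f K.0#) (≡.sym eq))

  coeff-zeon : ∀ (f : Subset n → Carrier) I → ⟨ zeon n f ,ζ I ⟩ ≡ f I
  coeff-zeon f I = ≡.cong (maybe′ f K.0#) (restrict-self I)

  -- Beyond a common bound both sides are zero. This is how identities known only on `Subset m`
  -- become equalities of zeons.
  ≈-bounded : ∀ {b} u v → Zeon.bound u ℕ.≤ b → Zeon.bound v ℕ.≤ b →
              (∀ (I : Subset b) → ⟨ u ,ζ I ⟩ K.≈ ⟨ v ,ζ I ⟩) → u ≈ v
  ≈-bounded {b} u v u≤b v≤b u≈v I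
    with restrict b I | coeff-bounded u u≤b I | coeff-bounded v v≤b I
  ... | just J  | eq₁ | eq₂ = K.trans eq₁ (K.trans (u≈v J) (K.sym eq₂))
  ... | nothing | eq₁ | eq₂ = K.trans eq₁ (K.sym eq₂)

  -- Coefficients of the operations, and the ring laws.

  coeff-+ : ∀ u v (I : Subset n) → ⟨ u + v ,ζ I ⟩ K.≈ ⟨ u ,ζ I ⟩ K.+ ⟨ v ,ζ I ⟩
  coeff-+ u v I with restrict (Zeon.bound u ℕ.⊔ Zeon.bound v) I
                   | coeff-bounded u (ℕ.m≤m⊔n (Zeon.bound u) (Zeon.bound v)) I
                   | coeff-bounded v (ℕ.m≤n⊔m (Zeon.bound u) (Zeon.bound v)) I
  ... | just _  | eq₁ | eq₂ = K.sym (K.+-cong eq₁ eq₂)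
  ... | nothing | eq₁ | eq₂ = K.sym (K.trans (K.+-cong eq₁ eq₂) (K.+-identityˡ K.0#))

  coeff-* : ∀ u v (I : Subset n) → ⟨ u * v ,ζ I ⟩ K.≈ conv ⟨ u ,ζ_⟩ ⟨ v ,ζ_⟩ I
  coeff-* u v I = K.sym (conv-bounded _ ⟨ u ,ζ_⟩ ⟨ v ,ζ_⟩
    (coeff-bounded u (ℕ.m≤m⊔n (Zeon.bound u) (Zeon.bound v)))
    (coeff-bounded v (ℕ.m≤n⊔m (Zeon.bound u) (Zeon.bound v))) I)

  coeff-neg : ∀ u (I : Subset n) → ⟨ - u ,ζ I ⟩ K.≈ K.- ⟨ u ,ζ I ⟩
  coeff-neg u I with restrict (Zeon.bound u) I
  ... | just _  = K.refl
  ... | nothing = K.sym K.-0#≈0#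

  coeff-sub : ∀ u v (I : Subset n) → ⟨ u - v ,ζ I ⟩ K.≈ ⟨ u ,ζ I ⟩ K.- ⟨ v ,ζ I ⟩
  coeff-sub u v I = K.trans (coeff-+ u (- v) I) (K.+-congˡ (coeff-neg v I))

  coeff-0# : ∀ (I : Subset n) → ⟨ 0# ,ζ I ⟩ K.≈ K.0#
  coeff-0# I with restrict 0 I
  ... | just _  = K.refl
  ... | nothing = K.refl

  coeff-sum : ∀ {k} (u : Fin k → Zeon) (I : Subset n) →
              ⟨ sum u ,ζ I ⟩ K.≈ K.sum (λ i → ⟨ u i ,ζ I ⟩)
  coeff-sum {k = zero}  u I = coeff-0# I
  coeff-sum {k = suc k} u I =
    K.trans (coeff-+ (u zero) _ I) (K.+-congˡ (coeff-sum (u ∘ suc) I))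

  coeff-scalar-* : ∀ a u (I : Subset n) → ⟨ scalar a * u ,ζ I ⟩ K.≈ a K.* ⟨ u ,ζ I ⟩
  coeff-scalar-* a u I = K.trans (coeff-* (scalar a) u I) (conv-scalar a _ I)

  coeff-ζ-∈ : ∀ (j : Fin n) u I → j ∈ I → ⟨ ζ ⁅ j ⁆ * u ,ζ I ⟩ K.≈ ⟨ u ,ζ I ∖ j ⟩
  coeff-ζ-∈ j u I j∈I = K.trans (coeff-* (ζ ⁅ j ⁆) u I) (K.trans
    (conv-cong (λ J → K.reflexive (coeff-zeon (indicator ⁅ j ⁆) J)) (λ _ → K.refl) I)
    (conv-indicator-∈ ⟨ u ,ζ_⟩ j∈I))

  coeff-ζ-∉ : ∀ (j : Fin n) u I → j ∉ I → ⟨ ζ ⁅ j ⁆ * u ,ζ I ⟩ K.≈ K.0#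
  coeff-ζ-∉ j u I j∉I = K.trans (coeff-* (ζ ⁅ j ⁆) u I) (K.trans
    (conv-cong (λ J → K.reflexive (coeff-zeon (indicator ⁅ j ⁆) J)) (λ _ → K.refl) I)
    (conv-indicator-∉ ⟨ u ,ζ_⟩ j∉I))

  𝔠-* : ∀ u v → 𝔠 (u * v) K.≈ 𝔠 u K.* 𝔠 v
  𝔠-* u v = coeff-* u v []

  𝔠-coeff-∅ : ∀ n u → ⟨ u ,ζ ∅ {n} ⟩ ≡ 𝔠 u
  𝔠-coeff-∅ n u = ≡.cong (maybe′ (Zeon.coeffs u) K.0#) (restrict-∅ (Zeon.bound u) n)

  𝔠-ζ : ∀ (j : Fin n) → 𝔠 (ζ ⁅ j ⁆) ≡ K.0#
  𝔠-ζ zero    = ≡.refl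
  𝔠-ζ (suc j) = 𝔠-ζ j

  zeonRing : CommutativeRing c ℓ
  zeonRing = record
    { Carrier = Zeon
    ; _≈_ = _≈_
    ; _+_ = _+_
    ; _*_ = _*_
    ; -_  = -_
    ; 0#  = 0#
    ; 1#  = 1#
    ; isCommutativeRing = record
      { isRing = record
        { +-isAbelianGroup = record
          { isGroup = record
            { isMonoid = record
              { isSemigroup = record
                { isMagma = record
                  { isEquivalence = record
                    { refl  = λ _ → K.refl
                    ; sym   = λ u≈v I → K.sym (u≈v I)
                    ; trans = λ u≈v v≈w I → K.trans (u≈v I) (v≈w I)
                    }
                  ; ∙-cong = λ {u} {u′} {v} {v′} u≈u′ v≈v′ I → K.trans (coeff-+ u v I)
                      (K.trans (K.+-cong (u≈u′ I) (v≈v′ I)) (K.sym (coeff-+ u′ v′ I)))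
                  }
                ; assoc = λ u v w I → K.begin
                    ⟨ (u + v) + w ,ζ I ⟩                        K.≈⟨ coeff-+ (u + v) w I ⟩
                    ⟨ u + v ,ζ I ⟩ K.+ ⟨ w ,ζ I ⟩               K.≈⟨ K.+-congʳ (coeff-+ u v I) ⟩
                    ⟨ u ,ζ I ⟩ K.+ ⟨ v ,ζ I ⟩ K.+ ⟨ w ,ζ I ⟩    K.≈⟨ K.+-assoc _ _ _ ⟩
                    ⟨ u ,ζ I ⟩ K.+ (⟨ v ,ζ I ⟩ K.+ ⟨ w ,ζ I ⟩)  K.≈⟨ K.+-congˡ (coeff-+ v w I) ⟨
                    ⟨ u ,ζ I ⟩ K.+ ⟨ v + w ,ζ I ⟩               K.≈⟨ coeff-+ u (v + w) I ⟨
                    ⟨ u + (v + w) ,ζ I ⟩                        K.∎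
                }
              ; identity =
                  (λ u I → K.trans (coeff-+ 0# u I) (K.trans (K.+-congʳ (coeff-0# I)) (K.+-identityˡ _)))
                , (λ u I → K.trans (coeff-+ u 0# I) (K.trans (K.+-congˡ (coeff-0# I)) (K.+-identityʳ _)))
              }
            ; inverse =
                (λ u I → K.trans (coeff-+ (- u) u I) (K.trans (K.+-congʳ (coeff-neg u I))
                  (K.trans (K.-‿inverseˡ _) (K.sym (coeff-0# I)))))
              , (λ u I → K.trans (coeff-sub u u I) (K.trans (K.-‿inverseʳ _) (K.sym (coeff-0# I))))
            ; ⁻¹-cong = λ {u} {v} u≈v I → K.trans (coeff-neg u I)
                (K.trans (K.-‿cong (u≈v I)) (K.sym (coeff-neg v I)))
            }
          ; comm = λ u v I → K.trans (coeff-+ u v I)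
              (K.trans (K.+-comm _ _) (K.sym (coeff-+ v u I)))
          }
        ; *-cong = λ {u} {u′} {v} {v′} u≈u′ v≈v′ I → K.trans (coeff-* u v I)
            (K.trans (conv-cong (λ J → u≈u′ J) (λ J → v≈v′ J) I) (K.sym (coeff-* u′ v′ I)))
        ; *-assoc = λ u v w I → K.begin
            ⟨ (u * v) * w ,ζ I ⟩
              K.≈⟨ coeff-* (u * v) w I ⟩
            conv ⟨ u * v ,ζ_⟩ ⟨ w ,ζ_⟩ I
              K.≈⟨ conv-cong (coeff-* u v) (λ _ → K.refl) I ⟩
            conv (conv ⟨ u ,ζ_⟩ ⟨ v ,ζ_⟩) ⟨ w ,ζ_⟩ I
              K.≈⟨ conv-assoc ⟨ u ,ζ_⟩ ⟨ v ,ζ_⟩ ⟨ w ,ζ_⟩ I ⟩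
            conv ⟨ u ,ζ_⟩ (conv ⟨ v ,ζ_⟩ ⟨ w ,ζ_⟩) I
              K.≈⟨ conv-cong (λ _ → K.refl) (coeff-* v w) I ⟨
            conv ⟨ u ,ζ_⟩ ⟨ v * w ,ζ_⟩ I
              K.≈⟨ coeff-* u (v * w) I ⟨
            ⟨ u * (v * w) ,ζ I ⟩
              K.∎
        ; *-identity = *-identityˡ , (λ u I → K.trans (*-comm u 1# I) (*-identityˡ u I))
        ; distrib = distribˡ , (λ w u v I → K.trans (*-comm (u + v) w I) (K.trans (distribˡ w u v I)
            (K.trans (coeff-+ (w * u) (w * v) I) (K.trans (K.+-cong (*-comm w u I) (*-comm w v I))
            (K.sym (coeff-+ (u * w) (v * w) I))))))
        }
      ; *-comm = *-comm
      }
    }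
    where
    *-comm : ∀ u v → u * v ≈ v * u
    *-comm u v I = K.trans (coeff-* u v I)
      (K.trans (conv-comm ⟨ u ,ζ_⟩ ⟨ v ,ζ_⟩ I) (K.sym (coeff-* v u I)))

    *-identityˡ : ∀ u → 1# * u ≈ u
    *-identityˡ u I = K.trans (coeff-scalar-* K.1# u I) (K.*-identityˡ _)

    distribˡ : ∀ w u v → w * (u + v) ≈ w * u + w * v
    distribˡ w u v I = K.begin
      ⟨ w * (u + v) ,ζ I ⟩
        K.≈⟨ coeff-* w (u + v) I ⟩
      conv ⟨ w ,ζ_⟩ ⟨ u + v ,ζ_⟩ I
        K.≈⟨ conv-cong (λ _ → K.refl) (coeff-+ u v) I ⟩
      conv ⟨ w ,ζ_⟩ (λ J → ⟨ u ,ζ J ⟩ K.+ ⟨ v ,ζ J ⟩) I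
        K.≈⟨ conv-distribˡ ⟨ w ,ζ_⟩ ⟨ u ,ζ_⟩ ⟨ v ,ζ_⟩ I ⟩
      conv ⟨ w ,ζ_⟩ ⟨ u ,ζ_⟩ I K.+ conv ⟨ w ,ζ_⟩ ⟨ v ,ζ_⟩ I
        K.≈⟨ K.+-cong (coeff-* w u I) (coeff-* w v I) ⟨
      ⟨ w * u ,ζ I ⟩ K.+ ⟨ w * v ,ζ I ⟩
        K.≈⟨ coeff-+ (w * u) (w * v) I ⟨
      ⟨ w * u + w * v ,ζ I ⟩
        K.∎

  -- Filtration by degree.

  VanishesBelow : ℕ → Zeon → Set ℓ
  VanishesBelow k u = ∀ {n} (I : Subset n) → ∣ I ∣ ℕ.< k → ⟨ u ,ζ I ⟩ K.≈ K.0#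

  coeff-*-lowest : ∀ {k} u v → VanishesBelow k v → ∀ (I : Subset n) → ∣ I ∣ ℕ.≤ k →
                   ⟨ u * v ,ζ I ⟩ K.≈ 𝔠 u K.* ⟨ v ,ζ I ⟩
  coeff-*-lowest {n = n} u v v-vanishes I ∣I∣≤k = K.trans (coeff-* u v I) (K.trans
    (conv-lowest ⟨ u ,ζ_⟩ ⟨ v ,ζ_⟩ (λ J → v-vanishes J) I ∣I∣≤k)
    (K.*-congʳ (K.reflexive (𝔠-coeff-∅ n u))))

  VanishesBelow-* : ∀ {k} u v → VanishesBelow k v → VanishesBelow k (u * v)
  VanishesBelow-* u v v-vanishes I ∣I∣<k =
    K.trans (coeff-*-lowest u v v-vanishes I (ℕ.<⇒≤ ∣I∣<k))
    (K.trans (K.*-congˡ (v-vanishes I ∣I∣<k)) (K.zeroʳ _))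

  -- In degree `k` only the term with factor `𝔠 u` could survive, and it is zero. This is the sense
  -- in which `Ψ` raises degrees.
  VanishesBelow-*-nilpotent : ∀ {k} u v → 𝔠 u K.≈ K.0# → VanishesBelow k v →
                              VanishesBelow (suc k) (u * v)
  VanishesBelow-*-nilpotent u v 𝔠u≈0 v-vanishes I (s≤s ∣I∣≤k) =
    K.trans (coeff-*-lowest u v v-vanishes I ∣I∣≤k) (K.trans (K.*-congʳ 𝔠u≈0) (K.zeroˡ _))

  VanishesBelow-sum : ∀ {k m} (u : Fin m → Zeon) → (∀ i → VanishesBelow k (u i)) →
                      VanishesBelow k (sum u)
  VanishesBelow-sum {m = zero}  u u-vanishes I _ = coeff-0# I
  VanishesBelow-sum {m = suc m} u u-vanishes I ∣I∣<k = K.trans (coeff-+ (u zero) _ I)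
    (K.trans (K.+-cong (u-vanishes zero I ∣I∣<k) (VanishesBelow-sum (u ∘ suc) (u-vanishes ∘ suc) I ∣I∣<k))
    (K.+-identityˡ K.0#))

  VanishesBelow-sub : ∀ {k} u v → VanishesBelow k u → VanishesBelow k v → VanishesBelow k (u - v)
  VanishesBelow-sub u v u-vanishes v-vanishes I ∣I∣<k = K.trans (coeff-sub u v I)
    (K.trans (K.+-cong (u-vanishes I ∣I∣<k) (K.-‿cong (v-vanishes I ∣I∣<k))) (K.-‿inverseʳ K.0#))

  ≈0-by-degree : ∀ u → (∀ k → VanishesBelow k u) → u ≈ 0#
  ≈0-by-degree u u-vanishes I = K.trans (u-vanishes (suc ∣ I ∣) I ℕ.≤-refl) (K.sym (coeff-0# I))

  -- The degree-`k` part of `u * v` is `𝔠 u` times that of `v`, and `a` divides it out: one stage of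
  -- division by a unit.
  VanishesBelow-suc : ∀ {k} a u v → a K.* 𝔠 u K.≈ K.1# → VanishesBelow k v →
                      VanishesBelow (suc k) (u * v) → VanishesBelow (suc k) v
  VanishesBelow-suc a u v a𝔠u≈1 v-vanishes uv-vanishes I (s≤s ∣I∣≤k) = K.begin
    ⟨ v ,ζ I ⟩                    K.≈⟨ K.*-identityˡ _ ⟨
    K.1# K.* ⟨ v ,ζ I ⟩           K.≈⟨ K.*-congʳ a𝔠u≈1 ⟨
    (a K.* 𝔠 u) K.* ⟨ v ,ζ I ⟩    K.≈⟨ K.*-assoc a _ _ ⟩
    a K.* (𝔠 u K.* ⟨ v ,ζ I ⟩)    K.≈⟨ K.*-congˡ (coeff-*-lowest u v v-vanishes I ∣I∣≤k) ⟨
    a K.* ⟨ u * v ,ζ I ⟩          K.≈⟨ K.*-congˡ (uv-vanishes I (s≤s ∣I∣≤k)) ⟩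
    a K.* K.0#                    K.≈⟨ K.zeroʳ a ⟩
    K.0#                          K.∎

  *-cancelˡ-0 : ∀ a u v → a K.* 𝔠 u K.≈ K.1# → u * v ≈ 0# → v ≈ 0#
  *-cancelˡ-0 a u v a𝔠u≈1 uv≈0 = ≈0-by-degree v v-vanishes
    where
    v-vanishes : ∀ k → VanishesBelow k v
    v-vanishes zero    _ ()
    v-vanishes (suc k) = VanishesBelow-suc a u v a𝔠u≈1 (v-vanishes k)
      λ I _ → K.trans (uv≈0 I) (coeff-0# I)

  -- The substitution ζ_i ↦ ζ_{i+1}.
  shift : Zeon → Zeon
  shift (zeon b f) = zeon (suc b) λ { (outside ∷ I) → f I ; (inside ∷ I) → K.0# }

  coeff-shift-outside : ∀ u (I : Subset n) → ⟨ shift u ,ζ outside ∷ I ⟩ ≡ ⟨ u ,ζ I ⟩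
  coeff-shift-outside u I with restrict (Zeon.bound u) I
  ... | just _  = ≡.refl
  ... | nothing = ≡.refl

  coeff-shift-inside : ∀ u (I : Subset n) → ⟨ shift u ,ζ inside ∷ I ⟩ ≡ K.0#
  coeff-shift-inside u I with restrict (Zeon.bound u) I
  ... | just _  = ≡.refl
  ... | nothing = ≡.refl

  shift-cong : ∀ {u v} → u ≈ v → shift u ≈ shift v
  shift-cong u≈v [] = u≈v []
  shift-cong {u} {v} u≈v (outside ∷ I)
    rewrite coeff-shift-outside u I | coeff-shift-outside v I = u≈v I
  shift-cong {u} {v} u≈v (inside ∷ I)
    rewrite coeff-shift-inside u I | coeff-shift-inside v I = K.refl

  shift-scalar : ∀ a → shift (scalar a) ≈ scalar a
  shift-scalar a []            = K.refl
  shift-scalar a (outside ∷ I) = K.reflexive (coeff-shift-outside (scalar a) I)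
  shift-scalar a (inside ∷ I)  = K.reflexive (coeff-shift-inside (scalar a) I)

  shift-ζ : ∀ (i : Fin n) → shift (ζ ⁅ i ⁆) ≈ ζ ⁅ suc i ⁆
  shift-ζ i [] = K.refl
  shift-ζ {n} i (outside ∷ I) with restrict n I
  ... | just _  = K.refl
  ... | nothing = K.refl
  shift-ζ {n} i (inside ∷ I) with restrict n I
  ... | just _  = K.refl
  ... | nothing = K.refl

  shift-+ : ∀ u v → shift (u + v) ≈ shift u + shift v
  shift-+ u v [] = K.trans (coeff-+ u v []) (K.sym (coeff-+ (shift u) (shift v) []))
  shift-+ u v (outside ∷ I) = K.begin
    ⟨ shift (u + v) ,ζ outside ∷ I ⟩
      K.≡⟨ coeff-shift-outside (u + v) I ⟩
    ⟨ u + v ,ζ I ⟩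
      K.≈⟨ coeff-+ u v I ⟩
    ⟨ u ,ζ I ⟩ K.+ ⟨ v ,ζ I ⟩
      K.≡⟨ ≡.cong₂ K._+_ (coeff-shift-outside u I) (coeff-shift-outside v I) ⟨
    ⟨ shift u ,ζ outside ∷ I ⟩ K.+ ⟨ shift v ,ζ outside ∷ I ⟩
      K.≈⟨ coeff-+ (shift u) (shift v) (outside ∷ I) ⟨
    ⟨ shift u + shift v ,ζ outside ∷ I ⟩
      K.∎
  shift-+ u v (inside ∷ I) = K.begin
    ⟨ shift (u + v) ,ζ inside ∷ I ⟩
      K.≡⟨ coeff-shift-inside (u + v) I ⟩
    K.0#
      K.≈⟨ K.+-identityˡ K.0# ⟨
    K.0# K.+ K.0#
      K.≡⟨ ≡.cong₂ K._+_ (coeff-shift-inside u I) (coeff-shift-inside v I) ⟨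
    ⟨ shift u ,ζ inside ∷ I ⟩ K.+ ⟨ shift v ,ζ inside ∷ I ⟩
      K.≈⟨ coeff-+ (shift u) (shift v) (inside ∷ I) ⟨
    ⟨ shift u + shift v ,ζ inside ∷ I ⟩
      K.∎

  shift-* : ∀ u v → shift (u * v) ≈ shift u * shift v
  shift-* u v [] = K.trans (coeff-* u v []) (K.sym (coeff-* (shift u) (shift v) []))
  shift-* u v (outside ∷ I) = K.begin
    ⟨ shift (u * v) ,ζ outside ∷ I ⟩
      K.≡⟨ coeff-shift-outside (u * v) I ⟩
    ⟨ u * v ,ζ I ⟩
      K.≈⟨ coeff-* u v I ⟩
    conv ⟨ u ,ζ_⟩ ⟨ v ,ζ_⟩ I
      K.≈⟨ conv-cong (λ J → K.reflexive (coeff-shift-outside u J))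
                     (λ J → K.reflexive (coeff-shift-outside v J)) I ⟨
    conv ⟨ shift u ,ζ_⟩ ⟨ shift v ,ζ_⟩ (outside ∷ I)
      K.≈⟨ coeff-* (shift u) (shift v) (outside ∷ I) ⟨
    ⟨ shift u * shift v ,ζ outside ∷ I ⟩
      K.∎
  shift-* u v (inside ∷ I) = K.begin
    ⟨ shift (u * v) ,ζ inside ∷ I ⟩
      K.≡⟨ coeff-shift-inside (u * v) I ⟩
    K.0#
      K.≈⟨ K.+-identityˡ K.0# ⟨
    K.0# K.+ K.0#
      K.≈⟨ K.+-cong (conv-zeroˡ _ (λ J → K.reflexive (coeff-shift-inside u J)) I)
                    (conv-zeroʳ _ (λ J → K.reflexive (coeff-shift-inside v J)) I) ⟨
    conv ⟨ shift u ,ζ_⟩ ⟨ shift v ,ζ_⟩ (inside ∷ I)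
      K.≈⟨ coeff-* (shift u) (shift v) (inside ∷ I) ⟨
    ⟨ shift u * shift v ,ζ inside ∷ I ⟩
      K.∎

  -- `shift` is a ring homomorphism that fixes scalars and carries generators to generators, so it
  -- follows the construction of a member of the subalgebra.
  shift-∈ : ∀ {m u} → InSubalgebra m u → InSubalgebra (suc m) (shift u)
  shift-∈ (scalar∈ a) = ≈∈ (CommutativeRing.sym zeonRing (shift-scalar a)) (scalar∈ a)
  shift-∈ (ζ∈ i)      = ≈∈ (CommutativeRing.sym zeonRing (shift-ζ i)) (ζ∈ (suc i))
  shift-∈ (+∈ u∈ v∈)  = ≈∈ (CommutativeRing.sym zeonRing (shift-+ _ _)) (+∈ (shift-∈ u∈) (shift-∈ v∈))
  shift-∈ (*∈ u∈ v∈)  = ≈∈ (CommutativeRing.sym zeonRing (shift-* _ _)) (*∈ (shift-∈ u∈) (shift-∈ v∈))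
  shift-∈ (≈∈ u≈v u∈) = ≈∈ (shift-cong u≈v) (shift-∈ u∈)

  -- Membership is generated by operations, while the entries of the eigenvector are given by
  -- coefficients. The induction uses f = f₀ + ζ_1 f₁, with both halves shifted from one generator
  -- fewer.
  zeon∈ : ∀ m (f : Subset m → Carrier) → InSubalgebra m (zeon m f)
  zeon∈ zero    f =
    ≈∈ (≈-bounded {b = 0} (scalar (f [])) (zeon 0 f) z≤n z≤n λ { [] → K.refl }) (scalar∈ (f []))
  zeon∈ (suc m) f = ≈∈ (≈-bounded (u + ζ ⁅ zero ⁆ * v) (zeon (suc m) f) bound≤ ℕ.≤-refl eq)
    (+∈ (shift-∈ (zeon∈ m _)) (*∈ (ζ∈ zero) (shift-∈ (zeon∈ m _))))
    where
    u v : Zeon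
    u = shift (zeon m (f ∘ (outside ∷_)))
    v = shift (zeon m (f ∘ (inside ∷_)))

    bound≤ : Zeon.bound (u + ζ {suc m} ⁅ zero ⁆ * v) ℕ.≤ suc m
    bound≤ = ℕ.⊔-lub ℕ.≤-refl (ℕ.⊔-lub ℕ.≤-refl ℕ.≤-refl)

    eq : ∀ I → ⟨ u + ζ {suc m} ⁅ zero ⁆ * v ,ζ I ⟩ K.≈ ⟨ zeon (suc m) f ,ζ I ⟩
    eq (outside ∷ I) = K.begin
      ⟨ u + ζ {suc m} ⁅ zero ⁆ * v ,ζ outside ∷ I ⟩
        K.≈⟨ coeff-+ u (ζ {suc m} ⁅ zero ⁆ * v) (outside ∷ I) ⟩
      ⟨ u ,ζ outside ∷ I ⟩ K.+ ⟨ ζ {suc m} ⁅ zero ⁆ * v ,ζ outside ∷ I ⟩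
        K.≈⟨ K.+-cong (K.reflexive (coeff-shift-outside (zeon m (f ∘ (outside ∷_))) I))
                      (coeff-ζ-∉ zero v (outside ∷ I) λ ()) ⟩
      ⟨ zeon m (f ∘ (outside ∷_)) ,ζ I ⟩ K.+ K.0#
        K.≈⟨ K.+-identityʳ _ ⟩
      ⟨ zeon m (f ∘ (outside ∷_)) ,ζ I ⟩
        K.≡⟨ coeff-zeon _ I ⟩
      f (outside ∷ I)
        K.≡⟨ coeff-zeon f (outside ∷ I) ⟨
      ⟨ zeon (suc m) f ,ζ outside ∷ I ⟩
        K.∎
    eq (inside ∷ I) = K.begin
      ⟨ u + ζ {suc m} ⁅ zero ⁆ * v ,ζ inside ∷ I ⟩
        K.≈⟨ coeff-+ u (ζ {suc m} ⁅ zero ⁆ * v) (inside ∷ I) ⟩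
      ⟨ u ,ζ inside ∷ I ⟩ K.+ ⟨ ζ {suc m} ⁅ zero ⁆ * v ,ζ inside ∷ I ⟩
        K.≈⟨ K.+-cong (K.reflexive (coeff-shift-inside (zeon m (f ∘ (outside ∷_))) I))
                      (coeff-ζ-∈ zero v (inside ∷ I) here) ⟩
      K.0# K.+ ⟨ v ,ζ outside ∷ (I ─ ∅) ⟩
        K.≈⟨ K.+-identityˡ _ ⟩
      ⟨ v ,ζ outside ∷ (I ─ ∅) ⟩
        K.≡⟨ ≡.cong (λ J → ⟨ v ,ζ outside ∷ J ⟩) (p─⊥≡p I) ⟩
      ⟨ v ,ζ outside ∷ I ⟩
        K.≡⟨ coeff-shift-outside (zeon m (f ∘ (inside ∷_))) I ⟩
      ⟨ zeon m (f ∘ (inside ∷_)) ,ζ I ⟩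
        K.≡⟨ coeff-zeon _ I ⟩
      f (inside ∷ I)
        K.≡⟨ coeff-zeon f (inside ∷ I) ⟨
      ⟨ zeon (suc m) f ,ζ inside ∷ I ⟩
        K.∎

-- Signs, and integers inside the real numbers.

-- The sign is its own inverse, so multiplying the number of walks by it gives the γ whose signed
-- value is that number.
-1^k*[-1^k*i]≡i : ∀ k i → (-1ℤ ℤ.^ k) ℤ.* ((-1ℤ ℤ.^ k) ℤ.* i) ≡ i
-1^k*[-1^k*i]≡i zero    i = ≡.trans (ℤ.*-identityˡ _) (ℤ.*-identityˡ i)
-1^k*[-1^k*i]≡i (suc k) i = begin
  -1ℤ ℤ.* s ℤ.* (-1ℤ ℤ.* s ℤ.* i)
    ≡⟨ ≡.cong₂ ℤ._*_ (ℤ.-1*i≡-i s) (≡.cong (ℤ._* i) (ℤ.-1*i≡-i s)) ⟩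
  ℤ.- s ℤ.* (ℤ.- s ℤ.* i)
    ≡⟨ ≡.cong (ℤ.- s ℤ.*_) (ℤ.neg-distribˡ-* s i) ⟨
  ℤ.- s ℤ.* ℤ.- (s ℤ.* i)
    ≡⟨ ℤ.neg-distribˡ-* s (ℤ.- (s ℤ.* i)) ⟨
  ℤ.- (s ℤ.* ℤ.- (s ℤ.* i))
    ≡⟨ ≡.cong ℤ.-_ (ℤ.neg-distribʳ-* s (s ℤ.* i)) ⟨
  ℤ.- ℤ.- (s ℤ.* (s ℤ.* i))
    ≡⟨ ℤ.neg-involutive _ ⟩
  s ℤ.* (s ℤ.* i)
    ≡⟨ -1^k*[-1^k*i]≡i k i ⟩
  i
    ∎
  where
  open ≡.≡-Reasoning
  s = -1ℤ ℤ.^ k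

module IntegersProperties {c ℓ₁ ℓ₂} (ℝ : RealNumbers c ℓ₁ ℓ₂) where
  private module ℝ where
    open RealNumbers ℝ public
    open CommutativeRing commutativeRing public
      using (ring; +-abelianGroup; +-commutativeSemigroup; +-monoid)
    open Algebra.Properties.Ring ring public
    open Algebra.Properties.AbelianGroup +-abelianGroup public using (⁻¹-∙-comm)
    open Algebra.Properties.CommutativeSemigroup +-commutativeSemigroup public using (interchange)
    open Algebra.Properties.Monoid.Mult +-monoid public using (×-homo-+)
    open Relation.Binary.Reasoning.Setoid setoid public
  open Integers ℝ

  private
    ι : ℕ → ℝ.Carrier
    ι n = n ℝ.· ℝ.1#

  fromℤ-neg : ∀ i → fromℤ (ℤ.- i) ℝ.≈ ℝ.- fromℤ i
  fromℤ-neg (+ zero)  = ℝ.sym ℝ.-0#≈0#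
  fromℤ-neg (+ suc n) = ℝ.refl
  fromℤ-neg -[1+ n ]  = ℝ.sym (ℝ.-‿involutive _)

  fromℤ-⊖ : ∀ m n → fromℤ (m ⊖ n) ℝ.≈ ι m ℝ.- ι n
  fromℤ-⊖ zero    zero    = ℝ.sym (ℝ.-‿inverseʳ ℝ.0#)
  fromℤ-⊖ (suc m) zero    = ℝ.sym (ℝ.trans (ℝ.+-congˡ ℝ.-0#≈0#) (ℝ.+-identityʳ _))
  fromℤ-⊖ zero    (suc n) = ℝ.sym (ℝ.+-identityˡ _)
  fromℤ-⊖ (suc m) (suc n) = ℝ.begin
    fromℤ (suc m ⊖ suc n)                           ℝ.≡⟨ ≡.cong fromℤ (ℤ.[1+m]⊖[1+n]≡m⊖n m n) ⟩
    fromℤ (m ⊖ n)                                   ℝ.≈⟨ fromℤ-⊖ m n ⟩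
    ι m ℝ.- ι n                                     ℝ.≈⟨ ℝ.+-identityˡ _ ⟨
    ℝ.0# ℝ.+ (ι m ℝ.- ι n)                          ℝ.≈⟨ ℝ.+-congʳ (ℝ.-‿inverseʳ ℝ.1#) ⟨
    (ℝ.1# ℝ.- ℝ.1#) ℝ.+ (ι m ℝ.- ι n)               ℝ.≈⟨ ℝ.interchange _ _ _ _ ⟩
    (ℝ.1# ℝ.+ ι m) ℝ.+ (ℝ.- ℝ.1# ℝ.- ι n)           ℝ.≈⟨ ℝ.+-congˡ (ℝ.⁻¹-∙-comm ℝ.1# (ι n)) ⟩
    (ℝ.1# ℝ.+ ι m) ℝ.- (ℝ.1# ℝ.+ ι n)               ℝ.∎

  -- The gaps are inverted as images of integers `d - deg j`, but the eigenvector equation contains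
  -- the difference of the images of `d` and `deg j`.
  fromℤ-sub : ∀ i n → fromℤ (i ℤ.- + n) ℝ.≈ fromℤ i ℝ.- ι n
  fromℤ-sub (+ m) zero = ℝ.trans (ℝ.reflexive (≡.cong ι (ℕ.+-identityʳ m)))
    (ℝ.sym (ℝ.trans (ℝ.+-congˡ ℝ.-0#≈0#) (ℝ.+-identityʳ _)))
  fromℤ-sub (+ m) (suc n) = fromℤ-⊖ m (suc n)
  fromℤ-sub -[1+ m ] zero = ℝ.sym (ℝ.trans (ℝ.+-congˡ ℝ.-0#≈0#) (ℝ.+-identityʳ _))
  fromℤ-sub -[1+ m ] (suc n) = ℝ.begin
    ℝ.- ι (suc (suc (m ℕ.+ n)))        ℝ.≡⟨ ≡.cong (ℝ.-_ ∘ ι ∘ suc) (ℕ.+-suc m n) ⟨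
    ℝ.- ι (suc m ℕ.+ suc n)            ℝ.≈⟨ ℝ.-‿cong (ℝ.×-homo-+ ℝ.1# (suc m) (suc n)) ⟩
    ℝ.- (ι (suc m) ℝ.+ ι (suc n))      ℝ.≈⟨ ℝ.⁻¹-∙-comm _ _ ⟨
    ℝ.- ι (suc m) ℝ.- ι (suc n)        ℝ.∎

  inverse-inverse : ∀ i i≢0 → fromℤ i ℝ.* inverse i i≢0 ℝ.≈ ℝ.1#
  inverse-inverse i i≢0 = ℝ.trans
    (ℝ.*-congʳ (ℝ.sym (ℝ.trans (ℝ.+-congˡ ℝ.-0#≈0#) (ℝ.+-identityʳ _))))
    (proj₂ (proj₂ (ℝ.#⇒invertible (fromℤ#0 i i≢0))))

-- The complex numbers as a commutative ring with apartness.

module ComplexRing {c ℓ₁ ℓ₂} (ℝ : RealNumbers c ℓ₁ ℓ₂) where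
  private module ℝ where
    open RealNumbers ℝ public
    open CommutativeRing commutativeRing public using (ring; commutativeSemiring)
    open Algebra.Properties.Ring ring public
    open Relation.Binary.Reasoning.Setoid setoid public
  open Complex ℝ
  open Algebra.Solver.Ring.NaturalCoefficients.Default ℝ.commutativeSemiring

  -- Multiplication by -1 is opaque to the semiring solver, and the laws below
  -- hold with any element n in place of i².
  private
    n : ℝ.Carrier
    n = ℝ.- ℝ.1#

    sub≈ : ∀ x y → x ℝ.- y ℝ.≈ x ℝ.+ n ℝ.* y
    sub≈ x y = ℝ.+-congˡ (ℝ.sym (ℝ.-1*x≈-x y))

  open RawRing rawRing using () renaming (_+_ to _+ℂ_; -_ to -ℂ_)

  *ℂ-comm : ∀ z w → z *ℂ w ≈ℂ w *ℂ z
  *ℂ-comm (a +i b) (c +i d) =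
      ℝ.+-cong (ℝ.*-comm a c) (ℝ.-‿cong (ℝ.*-comm b d))
    , solve 4 (λ a b c d → a :* d :+ b :* c := c :* b :+ d :* a) ℝ.refl a b c d

  *ℂ-assoc : ∀ z w v → (z *ℂ w) *ℂ v ≈ℂ z *ℂ (w *ℂ v)
  *ℂ-assoc (a +i b) (c +i d) (e +i f) =
      (ℝ.begin
        (a ℝ.* c ℝ.- b ℝ.* d) ℝ.* e ℝ.- (a ℝ.* d ℝ.+ b ℝ.* c) ℝ.* f
          ℝ.≈⟨ sub≈ _ _ ⟩
        (a ℝ.* c ℝ.- b ℝ.* d) ℝ.* e ℝ.+ n ℝ.* ((a ℝ.* d ℝ.+ b ℝ.* c) ℝ.* f)
          ℝ.≈⟨ ℝ.+-congʳ (ℝ.*-congʳ (sub≈ _ _)) ⟩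
        (a ℝ.* c ℝ.+ n ℝ.* (b ℝ.* d)) ℝ.* e ℝ.+ n ℝ.* ((a ℝ.* d ℝ.+ b ℝ.* c) ℝ.* f)
          ℝ.≈⟨ solve 7 (λ a b c d e f n →
                 (a :* c :+ n :* (b :* d)) :* e :+ n :* ((a :* d :+ b :* c) :* f)
              := a :* (c :* e :+ n :* (d :* f)) :+ n :* (b :* (c :* f :+ d :* e))) ℝ.refl a b c d e f n ⟩
        a ℝ.* (c ℝ.* e ℝ.+ n ℝ.* (d ℝ.* f)) ℝ.+ n ℝ.* (b ℝ.* (c ℝ.* f ℝ.+ d ℝ.* e))
          ℝ.≈⟨ ℝ.+-congʳ (ℝ.*-congˡ (sub≈ _ _)) ⟨
        a ℝ.* (c ℝ.* e ℝ.- d ℝ.* f) ℝ.+ n ℝ.* (b ℝ.* (c ℝ.* f ℝ.+ d ℝ.* e))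
          ℝ.≈⟨ sub≈ _ _ ⟨
        a ℝ.* (c ℝ.* e ℝ.- d ℝ.* f) ℝ.- b ℝ.* (c ℝ.* f ℝ.+ d ℝ.* e)
          ℝ.∎)
    , (ℝ.begin
        (a ℝ.* c ℝ.- b ℝ.* d) ℝ.* f ℝ.+ (a ℝ.* d ℝ.+ b ℝ.* c) ℝ.* e
          ℝ.≈⟨ ℝ.+-congʳ (ℝ.*-congʳ (sub≈ _ _)) ⟩
        (a ℝ.* c ℝ.+ n ℝ.* (b ℝ.* d)) ℝ.* f ℝ.+ (a ℝ.* d ℝ.+ b ℝ.* c) ℝ.* e
          ℝ.≈⟨ solve 7 (λ a b c d e f n →
                 (a :* c :+ n :* (b :* d)) :* f :+ (a :* d :+ b :* c) :* e
              := a :* (c :* f :+ d :* e) :+ b :* (c :* e :+ n :* (d :* f))) ℝ.refl a b c d e f n ⟩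
        a ℝ.* (c ℝ.* f ℝ.+ d ℝ.* e) ℝ.+ b ℝ.* (c ℝ.* e ℝ.+ n ℝ.* (d ℝ.* f))
          ℝ.≈⟨ ℝ.+-congˡ (ℝ.*-congˡ (sub≈ _ _)) ⟨
        a ℝ.* (c ℝ.* f ℝ.+ d ℝ.* e) ℝ.+ b ℝ.* (c ℝ.* e ℝ.- d ℝ.* f)
          ℝ.∎)

  *ℂ-distribˡ : ∀ z w v → z *ℂ (w +ℂ v) ≈ℂ (z *ℂ w) +ℂ (z *ℂ v)
  *ℂ-distribˡ (a +i b) (c +i d) (e +i f) =
      (ℝ.begin
        a ℝ.* (c ℝ.+ e) ℝ.- b ℝ.* (d ℝ.+ f)
          ℝ.≈⟨ sub≈ _ _ ⟩
        a ℝ.* (c ℝ.+ e) ℝ.+ n ℝ.* (b ℝ.* (d ℝ.+ f))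
          ℝ.≈⟨ solve 7 (λ a b c d e f n →
                 a :* (c :+ e) :+ n :* (b :* (d :+ f))
              := (a :* c :+ n :* (b :* d)) :+ (a :* e :+ n :* (b :* f))) ℝ.refl a b c d e f n ⟩
        (a ℝ.* c ℝ.+ n ℝ.* (b ℝ.* d)) ℝ.+ (a ℝ.* e ℝ.+ n ℝ.* (b ℝ.* f))
          ℝ.≈⟨ ℝ.+-cong (sub≈ _ _) (sub≈ _ _) ⟨
        (a ℝ.* c ℝ.- b ℝ.* d) ℝ.+ (a ℝ.* e ℝ.- b ℝ.* f)
          ℝ.∎)
    , solve 6 (λ a b c d e f → a :* (d :+ f) :+ b :* (c :+ e)
                            := (a :* d :+ b :* c) :+ (a :* f :+ b :* e)) ℝ.refl a b c d e f

  fromℝ-* : ∀ x y → fromℝ x *ℂ fromℝ y ≈ℂ fromℝ (x ℝ.* y)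
  fromℝ-* x y =
      ℝ.trans (ℝ.+-congˡ (ℝ.trans (ℝ.-‿cong (ℝ.zeroˡ ℝ.0#)) ℝ.-0#≈0#)) (ℝ.+-identityʳ _)
    , ℝ.trans (ℝ.+-cong (ℝ.zeroʳ x) (ℝ.zeroˡ y)) (ℝ.+-identityʳ ℝ.0#)

  *ℂ-cong : ∀ {z z′ w w′} → z ≈ℂ z′ → w ≈ℂ w′ → z *ℂ w ≈ℂ z′ *ℂ w′
  *ℂ-cong (a≈ , b≈) (c≈ , d≈) =
      ℝ.+-cong (ℝ.*-cong a≈ c≈) (ℝ.-‿cong (ℝ.*-cong b≈ d≈))
    , ℝ.+-cong (ℝ.*-cong a≈ d≈) (ℝ.*-cong b≈ c≈)

  *ℂ-identityˡ : ∀ z → 1ℂ *ℂ z ≈ℂ z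
  *ℂ-identityˡ (a +i b) =
      ℝ.trans (ℝ.+-cong (ℝ.*-identityˡ a) (ℝ.trans (ℝ.-‿cong (ℝ.zeroˡ b)) ℝ.-0#≈0#)) (ℝ.+-identityʳ a)
    , ℝ.trans (ℝ.+-cong (ℝ.*-identityˡ b) (ℝ.zeroˡ a)) (ℝ.+-identityʳ b)

  complexRing : CommutativeRing c ℓ₁
  complexRing = record
    { Carrier = ℂ
    ; _≈_ = _≈ℂ_
    ; _+_ = _+ℂ_
    ; _*_ = _*ℂ_
    ; -_  = -ℂ_
    ; 0#  = 0ℂ
    ; 1#  = 1ℂ
    ; isCommutativeRing = record
      { isRing = record
        { +-isAbelianGroup = record
          { isGroup = record
            { isMonoid = record
              { isSemigroup = record
                { isMagma = record
                  { isEquivalence = record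
                    { refl  = ℝ.refl , ℝ.refl
                    ; sym   = λ (p , q) → ℝ.sym p , ℝ.sym q
                    ; trans = λ (p , q) (p′ , q′) → ℝ.trans p p′ , ℝ.trans q q′
                    }
                  ; ∙-cong = λ (p , q) (p′ , q′) → ℝ.+-cong p p′ , ℝ.+-cong q q′
                  }
                ; assoc = λ z w v → ℝ.+-assoc (re z) (re w) (re v) , ℝ.+-assoc (im z) (im w) (im v)
                }
              ; identity = (λ z → ℝ.+-identityˡ (re z) , ℝ.+-identityˡ (im z))
                         , (λ z → ℝ.+-identityʳ (re z) , ℝ.+-identityʳ (im z))
              }
            ; inverse = (λ z → ℝ.-‿inverseˡ (re z) , ℝ.-‿inverseˡ (im z))
                      , (λ z → ℝ.-‿inverseʳ (re z) , ℝ.-‿inverseʳ (im z))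
            ; ⁻¹-cong = λ (p , q) → ℝ.-‿cong p , ℝ.-‿cong q
            }
          ; comm = λ z w → ℝ.+-comm (re z) (re w) , ℝ.+-comm (im z) (im w)
          }
        ; *-cong = *ℂ-cong
        ; *-assoc = *ℂ-assoc
        ; *-identity = *ℂ-identityˡ , λ z → ≈ℂ-trans (*ℂ-comm z 1ℂ) (*ℂ-identityˡ z)
        ; distrib = *ℂ-distribˡ , λ z w v → ≈ℂ-trans (*ℂ-comm (w +ℂ v) z) (≈ℂ-trans (*ℂ-distribˡ z w v)
            (ℝ.+-cong (proj₁ (*ℂ-comm z w)) (proj₁ (*ℂ-comm z v))
            , ℝ.+-cong (proj₂ (*ℂ-comm z w)) (proj₂ (*ℂ-comm z v))))
        }
      ; *-comm = *ℂ-comm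
      }
    }
    where
    ≈ℂ-trans : ∀ {z w v} → z ≈ℂ w → w ≈ℂ v → z ≈ℂ v
    ≈ℂ-trans (p , q) (p′ , q′) = ℝ.trans p p′ , ℝ.trans q q′

  -- Cotransitivity places the new component apart from one of the two ends, and irreflexivity rules
  -- out the end to which it is equal.
  #-respˡ : ∀ {z w v} → z ≈ℂ w → z # v → w # v
  #-respˡ {z} {w} {v} (p , _) (inj₁ z#v) with ℝ.#-cotrans z#v (re w)
  ... | inj₁ z#w = contradiction z#w (ℝ.#-irrefl p)
  ... | inj₂ w#v = inj₁ w#v
  #-respˡ {z} {w} {v} (_ , p) (inj₂ z#v) with ℝ.#-cotrans z#v (im w)
  ... | inj₁ z#w = contradiction z#w (ℝ.#-irrefl p)
  ... | inj₂ w#v = inj₂ w#v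

  1#0 : 1ℂ # 0ℂ
  1#0 = inj₁ (Equivalence.from ℝ.#⇔<⊎> (inj₂ ℝ.0<1))

  im-conj* : ∀ z → im (conj z *ℂ z) ℝ.≈ ℝ.0#
  im-conj* (a +i b) = ℝ.trans (ℝ.+-congˡ (ℝ.trans (ℝ.sym (ℝ.-‿distribˡ-* b a)) (ℝ.-‿cong (ℝ.*-comm b a))))
    (ℝ.-‿inverseʳ _)

  -- The inverse is the conjugate divided by the squared modulus. The squared modulus has imaginary
  -- part 0, so the apartness must come from its real part.
  conj*#0⇒invertible : ∀ z → (conj z *ℂ z) # 0ℂ → ∃[ w ] w *ℂ z ≈ℂ 1ℂ
  conj*#0⇒invertible z (inj₂ im#0) = contradiction im#0 (ℝ.#-irrefl (im-conj* z))
  conj*#0⇒invertible z (inj₁ re#0) with ℝ.#⇒invertible re#0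
  ... | x , x*re≈1 , _ = fromℝ x *ℂ conj z , (begin
    (fromℝ x *ℂ conj z) *ℂ z          ≈⟨ *ℂ-assoc (fromℝ x) (conj z) z ⟩
    -- `x` is the inverse of the real part minus `0#`, so that subtraction is inserted here.
    fromℝ x *ℂ (conj z *ℂ z)          ≈⟨ *ℂ-cong {fromℝ x} (ℝ.refl , ℝ.refl)
                                           (ℝ.sym (ℝ.trans (ℝ.+-congˡ ℝ.-0#≈0#) (ℝ.+-identityʳ _)) , im-conj* z) ⟩
    fromℝ x *ℂ fromℝ (re (conj z *ℂ z) ℝ.- ℝ.0#)  ≈⟨ fromℝ-* x _ ⟩
    fromℝ (x ℝ.* (re (conj z *ℂ z) ℝ.- ℝ.0#))     ≈⟨ x*re≈1 , ℝ.refl ⟩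
    1ℂ                                ∎)
    where open Relation.Binary.Reasoning.Setoid (CommutativeRing.setoid complexRing)

-- Walks, their removal of a first step, and their enumeration.

x∉p-x : ∀ {n} (x : Fin n) (p : Subset n) → x ∉ p ∖ x
x∉p-x zero    (_ ∷ p) ()
x∉p-x (suc x) (_ ∷ p) (there x∈p-x) = x∉p-x x p x∈p-x

∣p∣≡1+∣p-x∣ : ∀ {n} {x : Fin n} {p} → x ∈ p → ∣ p ∣ ≡ suc ∣ p ∖ x ∣
∣p∣≡1+∣p-x∣ {p = _ ∷ p}       here        = ≡.cong (suc ∘ ∣_∣) (≡.sym (p─⊥≡p p))
∣p∣≡1+∣p-x∣ {p = inside ∷ _}  (there x∈p) = ≡.cong suc (∣p∣≡1+∣p-x∣ x∈p)
∣p∣≡1+∣p-x∣ {p = outside ∷ _} (there x∈p) = ∣p∣≡1+∣p-x∣ x∈p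

∣p-x∣≡k : ∀ {n k} {x : Fin n} {p} → ∣ p ∣ ≡ suc k → x ∈ p → ∣ p ∖ x ∣ ≡ k
∣p-x∣≡k ∣p∣≡1+k x∈p = ℕ.suc-injective (≡.trans (≡.sym (∣p∣≡1+∣p-x∣ x∈p)) ∣p∣≡1+k)

∣p∣≡0⇒p≡∅ : ∀ {n} {p : Subset n} → ∣ p ∣ ≡ 0 → p ≡ ∅
∣p∣≡0⇒p≡∅ ∣p∣≡0 = Empty-unique λ (x , x∈p) → contradiction (≡.trans (≡.sym ∣p∣≡0) (∣p∣≡1+∣p-x∣ x∈p)) λ ()

last-∈ : ∀ {a} {A : Set a} (xs : List A) {x} → List.last xs ≡ just x → x List.∈ xs
last-∈ (y ∷ [])     ≡.refl = here ≡.refl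
last-∈ (_ ∷ y ∷ ys) eq   = there (last-∈ (y ∷ ys) eq)

module Occurrences {m} (G : SimpleGraph m) where
  open SimpleGraph G using (occurrences)

  occurrences-here : ∀ v t → occurrences v (v ∷ t) ≡ suc (occurrences v t)
  occurrences-here v t = ≡.cong length (filter-accept (v Fin.≟_) {xs = t} ≡.refl)

  occurrences-there : ∀ {v x} t → v ≢ x → occurrences v (x ∷ t) ≡ occurrences v t
  occurrences-there t v≢x = ≡.cong length (filter-reject (_ Fin.≟_) {xs = t} v≢x)

  occurrences-∷ : ∀ v x t → occurrences v t ℕ.≤ occurrences v (x ∷ t)
  occurrences-∷ v x t with v Fin.≟ x
  ... | yes _ = ℕ.n≤1+n _
  ... | no  _ = ℕ.≤-refl

  occurrences-∈ : ∀ {v t} → v List.∈ t → 1 ℕ.≤ occurrences v t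
  occurrences-∈ v∈t = filter-some (_ Fin.≟_) v∈t

  Unique⇒occurrences≤1 : ∀ v {t} → Unique t → occurrences v t ℕ.≤ 1
  Unique⇒occurrences≤1 v [] = z≤n
  Unique⇒occurrences≤1 v {x ∷ t} (x∉t ∷ t-unique) with v Fin.≟ x
  ... | yes ≡.refl = s≤s (ℕ.≤-reflexive (≡.cong length (filter-none (v Fin.≟_) x∉t)))
  ... | no  _    = Unique⇒occurrences≤1 v t-unique

  occurrences≤1⇒Unique : ∀ t → (∀ v → occurrences v t ℕ.≤ 1) → Unique t
  occurrences≤1⇒Unique []      _  = []
  occurrences≤1⇒Unique (x ∷ t) ≤1 =
    All.¬Any⇒All¬ t (λ x∈t → ℕ.<⇒≱ (s≤s (occurrences-∈ x∈t))
      (≡.subst (ℕ._≤ 1) (occurrences-here x t) (≤1 x)))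
    ∷ occurrences≤1⇒Unique t (λ v → ℕ.≤-trans (occurrences-∷ v x t) (≤1 v))

-- A trail from l on I is the list (w₁, …, w_k) of the vertices that a path or a
-- PWIC (l, w₁, …, w_k) to r visits after its start; for l = r it is empty.
module Trails {m} (G : SimpleGraph m) (r : Fin m) where
  open SimpleGraph G
  open Occurrences G

  -- `I` holds the vertices still to be entered. Deleting each one on entry enforces that none is
  -- entered twice, while the start is left untouched and may belong to `I`. The condition `l ≢ r`
  -- in `step` makes a trail halt at its first arrival at `r`, matching the recursion for the
  -- entries with base case μ_r = 1.
  data Trail : Fin m → Subset m → List (Fin m) → Set where
    stop : Trail r ∅ []
    step : ∀ {l j I t} → l ≢ r → Adj l j → j ∈ I → Trail j (I ∖ j) t → Trail l I (j ∷ t)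

  Trail-last : ∀ {l I t} → Trail l I t → List.last (l ∷ t) ≡ just r
  Trail-last stop           = ≡.refl
  Trail-last (step _ _ _ p) = Trail-last p

  Trail-Linked : ∀ {l I t} → Trail l I t → Linked Adj (l ∷ t)
  Trail-Linked stop             = [-]
  Trail-Linked (step _ l~j _ p) = l~j ∷ Trail-Linked p

  Trail-∈⁻ : ∀ {l I t} → Trail l I t → ∀ {i} → i List.∈ t → i ∈ I
  Trail-∈⁻ (step _ _ j∈I p)                 (here ≡.refl) = j∈I
  Trail-∈⁻ (step {j = j} {I} _ _ j∈I p) (there i∈t) = p─q⊆p I ⁅ j ⁆ (Trail-∈⁻ p i∈t)

  Trail-∈⁺ : ∀ {l I t} → Trail l I t → ∀ {i} → i ∈ I → i List.∈ t
  Trail-∈⁺ stop                     i∈∅ = contradiction i∈∅ ∉⊥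
  Trail-∈⁺ (step {j = j} _ _ _ p) {i} i∈I with i Fin.≟ j
  ... | yes i≡j = here i≡j
  ... | no  i≢j = there (Trail-∈⁺ p (x∈p∧x≢y⇒x∈p-y i∈I i≢j))

  Trail-Unique : ∀ {l I t} → Trail l I t → Unique t
  Trail-Unique stop = []
  Trail-Unique (step {j = j} {I} _ _ _ p) =
    All.¬Any⇒All¬ _ (λ j∈t → x∉p-x j I (Trail-∈⁻ p j∈t)) ∷ Trail-Unique p

  -- The target occurs at the end of the non-empty remainder, in which `j` does not occur.
  head≢last : ∀ {j} t → All.All (j ≢_) t → List.last (j ∷ t) ≡ just r → t ≢ [] → j ≢ r
  head≢last []      _   _      t≢[] = contradiction ≡.refl t≢[]
  head≢last (x ∷ t) j∉t t-last _    ≡.refl = All.All¬⇒¬Any j∉t (last-∈ (x ∷ t) t-last)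

  -- The inequality is assumed only for non-empty `t`, since the recursion ends with the start equal
  -- to `r` and nothing left to visit.
  toTrail : ∀ {l I} t → (t ≢ [] → l ≢ r) → List.last (l ∷ t) ≡ just r → Linked Adj (l ∷ t) →
            Unique t → (∀ i → i ∈ I ⇔ i List.∈ t) → Trail l I t
  toTrail [] _ ≡.refl _ _ I⇔t
    with ≡.refl ← Empty-unique (λ (i , i∈I) → contradiction (Equivalence.to (I⇔t i) i∈I) λ ())
    = stop
  toTrail {l} {I} (j ∷ t) l≢r t-last (l~j ∷ t-linked) (j∉t ∷ t-unique) I⇔t =
    step (l≢r λ ()) l~j (Equivalence.from (I⇔t j) (here ≡.refl))
      (toTrail t (head≢last t j∉t t-last) t-last t-linked t-unique λ i → mk⇔ (to i) (from i))
    where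
    to : ∀ i → i ∈ I ∖ j → i List.∈ t
    to i i∈I-j with Equivalence.to (I⇔t i) (p─q⊆p I ⁅ j ⁆ i∈I-j)
    ... | here ≡.refl = contradiction i∈I-j (x∉p-x j I)
    ... | there i∈t = i∈t

    from : ∀ i → i List.∈ t → i ∈ I ∖ j
    from i i∈t = x∈p∧x≢y⇒x∈p-y (Equivalence.from (I⇔t i) (there i∈t))
      λ { ≡.refl → All.All¬⇒¬Any j∉t i∈t }

  -- The trail itself has no repetition, so the start occurs in it once or not at all; membership of
  -- `l` in `I` decides between a PWIC and a path.
  Trail⇒PathOrPWICOn : ∀ {l I t} → l ≢ r → Trail l I t → PathOrPWICOn l r I (l ∷ t)
  Trail⇒PathOrPWICOn {l} {I} {t} l≢r p = pathOrPWIC , λ i → mk⇔ (Trail-∈⁺ p) (Trail-∈⁻ p)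
    where
    walk : IsWalk l r (l ∷ t)
    walk = ≡.refl , Trail-last p , Trail-Linked p

    pathOrPWIC : IsPath l r (l ∷ t) ⊎ IsPWIC l r (l ∷ t)
    pathOrPWIC with l ∈? I
    ... | yes l∈I = inj₂ (l≢r , walk
      , ≡.trans (occurrences-here l t) (≡.cong suc (ℕ.≤-antisym
          (Unique⇒occurrences≤1 l (Trail-Unique p)) (occurrences-∈ (Trail-∈⁺ p l∈I))))
      , λ v v≢l → ≡.subst (ℕ._≤ 1) (≡.sym (occurrences-there t v≢l))
          (Unique⇒occurrences≤1 v (Trail-Unique p)))
    ... | no  l∉I = inj₁ (walk , All.¬Any⇒All¬ t (l∉I ∘ Trail-∈⁻ p) ∷ Trail-Unique p)

  -- Dropping the first entry leaves a list without repetition in both cases: for a PWIC it removes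
  -- one of the two occurrences of the start.
  PathOrPWICOn⇒Trail : ∀ {l I} w → l ≢ r → PathOrPWICOn l r I w → ∃[ t ] w ≡ l ∷ t × Trail l I t
  PathOrPWICOn⇒Trail (_ ∷ t) l≢r (inj₁ ((≡.refl , w-last , w-linked) , (_ ∷ t-unique)) , I⇔t) =
    t , ≡.refl , toTrail t (λ _ → l≢r) w-last w-linked t-unique I⇔t
  PathOrPWICOn⇒Trail {l} (_ ∷ t) l≢r (inj₂ (_ , (≡.refl , w-last , w-linked) , ≡2 , ≤1) , I⇔t) =
    t , ≡.refl , toTrail t (λ _ → l≢r) w-last w-linked (occurrences≤1⇒Unique t t≤1) I⇔t
    where
    t≤1 : ∀ v → occurrences v t ℕ.≤ 1
    t≤1 v with v Fin.≟ l
    ... | yes ≡.refl = ℕ.≤-reflexive (ℕ.suc-injective (≡.trans (≡.sym (occurrences-here l t)) ≡2))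
    ... | no  v≢l  = ℕ.≤-trans (occurrences-∷ v l t) (≤1 v v≢l)

  -- Enumerates the trails from l on I if k = ∣ I ∣.
  trails : ℕ → Fin m → Subset m → List (List (Fin m))

  -- The guard is the condition under which multiplication by `Ψ l j` contributes to the coefficient
  -- at `I`, so that counts and coefficients can be matched term by term.
  trailsVia : ℕ → Fin m → Subset m → Fin m → List (List (Fin m))
  trailsVia k l I j = if does (adj? l j ×-dec j ∈? I) then map (j ∷_) (trails k j (I ∖ j)) else []

  trails zero    l I = if does (l Fin.≟ r) then [] ∷ [] else []
  trails (suc k) l I = if does (l Fin.≟ r) then [] else concat (tabulate (trailsVia k l I))

  trails-sound : ∀ k l I → ∣ I ∣ ≡ k → ∀ {t} → t List.∈ trails k l I → Trail l I t
  trails-sound zero l I ∣I∣≡0 t∈ with l Fin.≟ r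
  trails-sound zero l I ∣I∣≡0 (here ≡.refl) | yes ≡.refl =
    ≡.subst (λ J → Trail r J []) (≡.sym (∣p∣≡0⇒p≡∅ {p = I} ∣I∣≡0)) stop
  trails-sound (suc k) l I ∣I∣≡1+k t∈ with l Fin.≟ r
  ... | no l≢r with ∈-concat⁻′ (tabulate (trailsVia k l I)) t∈
  ... | ts , t∈ts , ts∈ with ∈-tabulate⁻ ts∈
  ... | j , ≡.refl with adj? l j | j ∈? I
  ... | yes l~j | yes j∈I with ∈-map⁻ (j ∷_) t∈ts
  ... | t , t∈ , ≡.refl = step l≢r l~j j∈I (trails-sound k j (I ∖ j) (∣p-x∣≡k ∣I∣≡1+k j∈I) t∈)

  trails-complete : ∀ k {l I t} → ∣ I ∣ ≡ k → Trail l I t → t List.∈ trails k l I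
  trails-complete zero _ stop with r Fin.≟ r
  ... | yes _   = here ≡.refl
  ... | no  r≢r = contradiction ≡.refl r≢r
  trails-complete (suc k) ∣∅∣≡1+k stop = contradiction (≡.trans (≡.sym (∣⊥∣≡0 m)) ∣∅∣≡1+k) λ ()
  trails-complete zero ∣I∣≡0 (step _ _ j∈I _) =
    contradiction (≡.trans (≡.sym ∣I∣≡0) (∣p∣≡1+∣p-x∣ j∈I)) λ ()
  trails-complete (suc k) {l} {I} ∣I∣≡1+k (step {j = j} {t = t} l≢r l~j j∈I p) with l Fin.≟ r
  ... | yes l≡r = contradiction l≡r l≢r
  ... | no  _   = ∈-concat⁺′ j∷t∈ (∈-tabulate⁺ j)
    where
    j∷t∈ : (j ∷ t) List.∈ trailsVia k l I j
    j∷t∈ with adj? l j | j ∈? I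
    ... | yes _   | yes _   = ∈-map⁺ (j ∷_) (trails-complete k (∣p-x∣≡k ∣I∣≡1+k j∈I) p)
    ... | yes _   | no  j∉I = contradiction j∈I j∉I
    ... | no  l≁j | _       = contradiction l~j l≁j

  trailsVia-head : ∀ k l I j {t} → t List.∈ trailsVia k l I j → List.head t ≡ just j
  trailsVia-head k l I j t∈ with adj? l j | j ∈? I
  ... | yes _ | yes _ with ∈-map⁻ (j ∷_) t∈
  ... | _ , _ , ≡.refl = ≡.refl

  trails-Unique : ∀ k l I → Unique (trails k l I)
  trails-Unique zero l I with l Fin.≟ r
  ... | yes _ = All.[] ∷ []
  ... | no  _ = []
  trails-Unique (suc k) l I with l Fin.≟ r
  ... | yes _ = []
  -- The blocks for distinct first vertices are disjoint because their lists have different heads.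
  ... | no  _ = Unique.concat⁺ (All.tabulate⁺ via-Unique) (AllPairs.tabulate⁺ λ {i} {j} i≢j (t∈i , t∈j) →
      i≢j (just-injective (≡.trans (≡.sym (trailsVia-head k l I i t∈i)) (trailsVia-head k l I j t∈j))))
    where
    via-Unique : ∀ j → Unique (trailsVia k l I j)
    via-Unique j with adj? l j | j ∈? I
    ... | yes _ | yes _ = Unique.map⁺ ∷-injectiveʳ (trails-Unique k j (I ∖ j))
    ... | yes _ | no  _ = []
    ... | no  _ | _     = []

  #trails : Fin m → Subset m → ℕ
  #trails l I = length (trails ∣ I ∣ l I)

  HasExactly-#trails : ∀ {l} → l ≢ r → ∀ I → HasExactly (#trails l I) (PathOrPWICOn l r I)
  HasExactly-#trails {l} l≢r I =
    map (l ∷_) (trails ∣ I ∣ l I)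
    , Unique.map⁺ ∷-injectiveʳ (trails-Unique ∣ I ∣ l I)
    , (λ w → mk⇔ (to w) (from w))
    , length-map (l ∷_) (trails ∣ I ∣ l I)
    where
    to : ∀ w → w List.∈ map (l ∷_) (trails ∣ I ∣ l I) → PathOrPWICOn l r I w
    to w w∈ with ∈-map⁻ (l ∷_) w∈
    ... | t , t∈ , ≡.refl = Trail⇒PathOrPWICOn l≢r (trails-sound ∣ I ∣ l I ≡.refl t∈)

    from : ∀ w → PathOrPWICOn l r I w → w List.∈ map (l ∷_) (trails ∣ I ∣ l I)
    from w p with PathOrPWICOn⇒Trail w l≢r p
    ... | t , ≡.refl , q = ∈-map⁺ (l ∷_) (trails-complete ∣ I ∣ ≡.refl q)

  -- A trail from elsewhere is non-empty and its last recorded vertex is `r`. This is the source of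
  -- the divisibility by ζ_r.
  #trails-r∉ : ∀ {l I} → l ≢ r → r ∉ I → #trails l I ≡ 0
  #trails-r∉ {l} {I} l≢r r∉I with trails ∣ I ∣ l I in eq
  ... | []    = ≡.refl
  ... | t ∷ _ = contradiction (ends p) r∉I
    where
    p : Trail l I t
    p = trails-sound ∣ I ∣ l I ≡.refl (≡.subst (t List.∈_) (≡.sym eq) (here ≡.refl))

    ends : Trail l I t → r ∈ I
    ends (step _ _ _ q) = Trail-∈⁻ p (last-∈ _ (Trail-last q))
    ends stop           = contradiction ≡.refl l≢r

  #trails-r-∅ : ∀ {I} → ∣ I ∣ ≡ 0 → #trails r I ≡ 1
  #trails-r-∅ ∣I∣≡0 rewrite ∣I∣≡0 | dec-true (r Fin.≟ r) ≡.refl = ≡.refl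

  #trails-r-suc : ∀ {k I} → ∣ I ∣ ≡ suc k → #trails r I ≡ 0
  #trails-r-suc ∣I∣≡1+k rewrite ∣I∣≡1+k | dec-true (r Fin.≟ r) ≡.refl = ≡.refl

  #trails-∅ : ∀ {l I} → l ≢ r → ∣ I ∣ ≡ 0 → #trails l I ≡ 0
  #trails-∅ {l} l≢r ∣I∣≡0 rewrite ∣I∣≡0 | dec-false (l Fin.≟ r) l≢r = ≡.refl

  #trails-suc : ∀ {k l I} → l ≢ r → ∣ I ∣ ≡ suc k →
                #trails l I ≡ length (concat (tabulate (trailsVia k l I)))
  #trails-suc {l = l} l≢r ∣I∣≡1+k rewrite ∣I∣≡1+k | dec-false (l Fin.≟ r) l≢r = ≡.refl

-- Sums with one distinguished term.

module SumProperties {a ℓ} (M : CommutativeMonoid a ℓ) where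
  open CommutativeMonoid M
  open Algebra.Properties.CommutativeMonoid.Sum M
  open Algebra.Properties.CommutativeSemigroup commutativeSemigroup using (x∙yz≈y∙xz)

  -- `t′` is `t` with its term at `i` replaced by the unit. The general monoid serves both sums of
  -- zeons or scalars and, multiplicatively, the products of inverse gaps.
  sum-split : ∀ {n} (t t′ : Fin n → Carrier) i → t′ i ≈ ε → (∀ j → j ≢ i → t j ≈ t′ j) →
              sum t ≈ t i ∙ sum t′
  sum-split t t′ zero t′i≈ε t≈t′ = ∙-congˡ (trans
    (sum-cong-≋ λ j → t≈t′ (suc j) λ ()) (sym (trans (∙-congʳ t′i≈ε) (identityˡ _))))
  sum-split t t′ (suc i) t′i≈ε t≈t′ = trans
    (∙-cong (t≈t′ zero λ ()) (sum-split (t ∘ suc) (t′ ∘ suc) i t′i≈ε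
      λ j j≢i → t≈t′ (suc j) (j≢i ∘ Fin.suc-injective)))
    (x∙yz≈y∙xz _ _ _)

  sum-single : ∀ {n} (t : Fin n → Carrier) i → (∀ j → j ≢ i → t j ≈ ε) → sum t ≈ t i
  sum-single {n} t i t≈ε = trans (sum-split t (λ _ → ε) i refl t≈ε)
    (trans (∙-congˡ (sum-replicate-zero n)) (identityʳ (t i)))

-- The Laplacian with arbitrary diagonal over a commutative ring.

module ZeonSpectrum {c ℓ} (K : CommutativeRing c ℓ) {m} (G : SimpleGraph m) (r : Fin m)
  (δ : Fin m → CommutativeRing.Carrier K) where

  open SimpleGraph G
  open Trails G r

  private
    module K where
      open CommutativeRing K public
      open Algebra.Properties.Ring ring public
      open Algebra.Properties.AbelianGroup +-abelianGroup public using (⁻¹-∙-comm)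
      open Algebra.Properties.Semiring.Sum semiring public
        using (sum; sum-cong-≋; *-distribˡ-sum; *-distribʳ-sum; sum-replicate-zero)
      open Algebra.Properties.Semiring.Mult semiring public
        using (×-homo-+; ×-homo-1; ×-congˡ) renaming (_×_ to _·_)
      open Algebra.Properties.CommutativeSemigroup *-commutativeSemigroup public using (x∙yz≈y∙xz)
      open Relation.Binary.Reasoning.Setoid setoid public

  open ZeonAlgebra K.rawRing
  open ZeonRing K

  private
    module Z where
      open CommutativeRing zeonRing public
      open Algebra.Properties.Ring ring public
      open Algebra.Properties.Semiring.Sum semiring public
        using (sum-cong-≋; *-distribˡ-sum; ∑-distrib-+; sum-replicate-zero)
      open SumProperties +-commutativeMonoid public
      open Algebra.Properties.CommutativeSemigroup *-commutativeSemigroup public using (x∙yz≈y∙xz)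
      open Algebra.Properties.AbelianGroup +-abelianGroup public
        using (⁻¹-∙-comm) renaming (x∙y⁻¹≈ε⇒x≈y to x-y≈0⇒x≈y)
      open Relation.Binary.Reasoning.Setoid setoid public

  Ψ Δ Λ : Fin m → Fin m → Zeon
  Ψ i j = if does (adj? i j) then ζ ⁅ j ⁆ else 0#
  Δ i j = if does (i Fin.≟ j) then scalar (δ i) else 0#
  Λ i j = Δ i j - Ψ i j

  Ψ·_ : (Fin m → Zeon) → Fin m → Zeon
  (Ψ· v) i = sum λ j → Ψ i j * v j

  Λ·≈ : ∀ v i → sum (λ j → Λ i j * v j) ≈ scalar (δ i) * v i - (Ψ· v) i
  Λ·≈ v i = Z.begin
    sum (λ j → Λ i j * v j)
      -- Negation is written as multiplication by `- 1#` so that it can be moved out of the sum by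
      -- distributivity.
      Z.≈⟨ Z.sum-cong-≋ (λ j → Z.trans (Z.distribʳ (v j) (Δ i j) (- Ψ i j))
             (Z.+-congˡ (Z.trans (Z.sym (Z.-‿distribˡ-* (Ψ i j) (v j))) (Z.sym (Z.-1*x≈-x _))))) ⟩
    sum (λ j → Δ i j * v j + - 1# * (Ψ i j * v j))
      Z.≈⟨ Z.∑-distrib-+ (λ j → Δ i j * v j) _ ⟩
    sum (λ j → Δ i j * v j) + sum (λ j → - 1# * (Ψ i j * v j))
      Z.≈⟨ Z.+-cong diagonal (Z.trans (Z.sym (Z.*-distribˡ-sum (- 1#) (λ j → Ψ i j * v j))) (Z.-1*x≈-x _)) ⟩
    scalar (δ i) * v i - (Ψ· v) i
      Z.∎
    where
    off-diagonal : ∀ j → j ≢ i → Δ i j * v j ≈ 0#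
    off-diagonal j j≢i rewrite dec-false (i Fin.≟ j) (j≢i ∘ ≡.sym) = Z.zeroˡ (v j)

    on-diagonal : Δ i i * v i ≈ scalar (δ i) * v i
    on-diagonal rewrite dec-true (i Fin.≟ i) ≡.refl = Z.refl

    diagonal : sum (λ j → Δ i j * v j) ≈ scalar (δ i) * v i
    diagonal = Z.trans (Z.sum-single _ i off-diagonal) on-diagonal

  Ψ·-sub : ∀ u a v i → (Ψ· (λ j → u j - a * v j)) i ≈ (Ψ· u) i - a * (Ψ· v) i
  Ψ·-sub u a v i = Z.begin
    sum (λ j → Ψ i j * (u j - a * v j))
      Z.≈⟨ Z.sum-cong-≋ (λ j → Z.trans (Z.distribˡ (Ψ i j) (u j) _)
             (Z.+-congˡ (Z.trans (Z.*-congˡ (Z.-‿distribˡ-* a (v j))) (Z.x∙yz≈y∙xz (Ψ i j) (- a) (v j))))) ⟩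
    sum (λ j → Ψ i j * u j + - a * (Ψ i j * v j))
      Z.≈⟨ Z.∑-distrib-+ (λ j → Ψ i j * u j) _ ⟩
    (Ψ· u) i + sum (λ j → - a * (Ψ i j * v j))
      Z.≈⟨ Z.+-congˡ (Z.trans (Z.sym (Z.*-distribˡ-sum (- a) (λ j → Ψ i j * v j))) (Z.sym (Z.-‿distribˡ-* a _))) ⟩
    (Ψ· u) i - a * (Ψ· v) i
      Z.∎

  𝔠-Ψ : ∀ i j → 𝔠 (Ψ i j) K.≈ K.0#
  𝔠-Ψ i j with does (adj? i j)
  ... | true  = K.reflexive (𝔠-ζ j)
  ... | false = K.refl

  VanishesBelow-Ψ· : ∀ {k} v i → (∀ j → VanishesBelow k (v j)) → VanishesBelow (suc k) ((Ψ· v) i)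
  VanishesBelow-Ψ· v i v-vanishes = VanishesBelow-sum _ λ j →
    VanishesBelow-*-nilpotent (Ψ i j) (v j) (𝔠-Ψ i j) (v-vanishes j)

  coeff-Ψ* : ∀ i j v (I : Subset m) →
    ⟨ Ψ i j * v ,ζ I ⟩ K.≈ (if does (adj? i j ×-dec j ∈? I) then ⟨ v ,ζ I ∖ j ⟩ else K.0#)
  coeff-Ψ* i j v I with does (adj? i j)
  ... | false = K.trans (Z.zeroˡ v I) (coeff-0# I)
  ... | true with j ∈? I
  ...   | yes j∈I = coeff-ζ-∈ j v I j∈I
  ...   | no  j∉I = coeff-ζ-∉ j v I j∉I

  bound-Ψ· : ∀ v i → (∀ j → Zeon.bound (v j) ℕ.≤ m) → Zeon.bound ((Ψ· v) i) ℕ.≤ m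
  bound-Ψ· v i v≤m = bound-sum (λ j → Ψ i j * v j) λ j → ℕ.⊔-lub (bound-Ψ j) (v≤m j)
    where
    bound-Ψ : ∀ j → Zeon.bound (Ψ i j) ℕ.≤ m
    bound-Ψ j with does (adj? i j)
    ... | true  = ℕ.≤-refl
    ... | false = z≤n

    bound-sum : ∀ {k} (u : Fin k → Zeon) → (∀ j → Zeon.bound (u j) ℕ.≤ m) → Zeon.bound (sum u) ℕ.≤ m
    bound-sum {zero}  u _   = z≤n
    bound-sum {suc k} u u≤m = ℕ.⊔-lub (u≤m zero) (bound-sum (u ∘ suc) (u≤m ∘ suc))

  Ψ*-symm : ∀ i j v → Ψ i j * v ≈ (if does (adj? j i) then ζ ⁅ j ⁆ * v else 0#)
  Ψ*-symm i j v with adj? i j | adj? j i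
  ... | yes _   | yes _   = Z.refl
  ... | no  _   | no  _   = Z.zeroˡ v
  ... | yes i~j | no  j≁i = contradiction (symm i~j) j≁i
  ... | no  i≁j | yes j~i = contradiction (symm j~i) i≁j

  -- The eigenvector at a diagonal value attained only at `r`.

  module SimpleEigenvalue
    (e : K.Carrier)
    (gap⁻¹ : ∀ j → j ≢ r → K.Carrier)
    (gap⁻¹-inverse : ∀ j j≢r → (e K.- δ j) K.* gap⁻¹ j j≢r K.≈ K.1#)
    (δr≈e : δ r K.≈ e)
    -- `P I` stands for the product of the inverse gaps over `I` without `r`; the next two
    -- hypotheses are all that is used of it.
    (P : Subset m → K.Carrier)
    (P-⁅r⁆ : ∀ I → r ∈ I → I ∖ r ≡ ∅ → P I K.≈ K.1#)
    (P-∈ : ∀ I j → j ∈ I → (j≢r : j ≢ r) → P I K.≈ gap⁻¹ j j≢r K.* P (I ∖ j))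
    where

    sign : ℕ → K.Carrier
    sign zero    = K.1#
    sign (suc k) = K.- sign k

    signed : Fin m → Subset m → K.Carrier
    signed l I = sign ∣ I ∣ K.* (#trails l I K.· K.1#)

    -- The decision is an argument because its negative case supplies the proof demanded by `gap⁻¹`.
    entry : ∀ l → Dec (l ≡ r) → Zeon
    entry l (yes _)   = 1#
    entry l (no l≢r) = zeon m λ I → signed l I K.* gap⁻¹ l l≢r K.* P I

    μ : Fin m → Zeon
    μ l = entry l (l Fin.≟ r)

    μ-r : μ r ≡ 1#
    μ-r with r Fin.≟ r
    ... | yes _   = ≡.refl
    ... | no  r≢r = contradiction ≡.refl r≢r

    coeff-μ : ∀ l (l≢r : l ≢ r) (I : Subset m) → ⟨ μ l ,ζ I ⟩ ≡ signed l I K.* gap⁻¹ l l≢r K.* P I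
    coeff-μ l l≢r I with l Fin.≟ r
    ... | yes l≡r = contradiction l≡r l≢r
    -- Refutations of `l ≡ r` are definitionally equal, so the one found by the decision stands for
    -- the given `l≢r`.
    ... | no  _   = coeff-zeon _ I

    bound-μ : ∀ l → Zeon.bound (μ l) ℕ.≤ m
    bound-μ l with l Fin.≟ r
    ... | yes _ = z≤n
    ... | no  _ = ℕ.≤-refl

    signed-r∉ : ∀ l {I} → l ≢ r → r ∉ I → signed l I K.≈ K.0#
    signed-r∉ l {I} l≢r r∉I = K.trans (K.*-congˡ (K.×-congˡ (#trails-r∉ l≢r r∉I))) (K.zeroʳ _)

    μ-multiple : ∀ l → l ≢ r → ∀ I → r ∉ I → ⟨ μ l ,ζ I ⟩ K.≈ K.0#
    μ-multiple l l≢r I r∉I = K.trans (K.reflexive (coeff-μ l l≢r I))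
      (K.trans (K.*-congʳ (K.trans (K.*-congʳ (signed-r∉ l l≢r r∉I)) (K.zeroˡ _))) (K.zeroˡ _))

    -- The entry `μ r` is 1, not a multiple of ζ_r, but it does not enter row `r` because the graph
    -- has no loops.
    Ψμr-multiple : ∀ I → r ∉ I → ⟨ (Ψ· μ) r ,ζ I ⟩ K.≈ K.0#
    Ψμr-multiple I r∉I = K.trans (coeff-sum (λ j → Ψ r j * μ j) I)
      (K.trans (K.sum-cong-≋ term) (K.sum-replicate-zero m))
      where
      term : ∀ j → ⟨ Ψ r j * μ j ,ζ I ⟩ K.≈ K.0#
      term j = K.trans (coeff-Ψ* r j (μ j) I) go
        where
        go : (if does (adj? r j ×-dec j ∈? I) then ⟨ μ j ,ζ I ∖ j ⟩ else K.0#) K.≈ K.0#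
        go with adj? r j | j ∈? I
        ... | yes r~j | yes _ = μ-multiple j (λ j≡r → irrefl (≡.sym j≡r) r~j) (I ∖ j) (r∉I ∘ p─q⊆p I ⁅ j ⁆)
        ... | yes _   | no  _ = K.refl
        ... | no  _   | _     = K.refl

    -- Both factors contain ζ_r. This serves twice: for the product with the nilpotent part of the
    -- eigenvalue, and for the square of an entry.
    multiple-*-μ : ∀ {u} l → l ≢ r → Zeon.bound u ℕ.≤ m →
                   (∀ (I : Subset m) → r ∉ I → ⟨ u ,ζ I ⟩ K.≈ K.0#) →
                   u * μ l ≈ 0#
    multiple-*-μ {u} l l≢r u≤m u-multiple = ≈-bounded (u * μ l) 0# (ℕ.⊔-lub u≤m (bound-μ l)) z≤n λ I →
      K.trans (coeff-* u (μ l) I)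
      (K.trans (conv-multiples r u-multiple (μ-multiple l l≢r) I) (K.sym (coeff-0# I)))

    -- The common value of (e - δ l) * μ l and - (Ψ· μ) l.
    flow : Fin m → Zeon
    flow l = zeon m λ I → signed l I K.* P I

    scalar-gap : ∀ l → l ≢ r → scalar e * μ l ≈ scalar (δ l) * μ l + flow l
    scalar-gap l l≢r = ≈-bounded (scalar e * μ l) (scalar (δ l) * μ l + flow l)
      (bound-μ l) (ℕ.⊔-lub (bound-μ l) ℕ.≤-refl) λ I → let x = ⟨ μ l ,ζ I ⟩ in K.begin
        ⟨ scalar e * μ l ,ζ I ⟩
          K.≈⟨ coeff-scalar-* e (μ l) I ⟩
        e K.* x
          K.≈⟨ K.*-congʳ (K.trans (K.sym (K.+-identityʳ e)) (K.trans (K.+-congˡ (K.sym (K.-‿inverseˡ (δ l))))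
                 (K.sym (K.+-assoc e (K.- δ l) (δ l))))) ⟩
        (e K.- δ l K.+ δ l) K.* x
          K.≈⟨ K.trans (K.distribʳ x _ (δ l)) (K.+-comm _ _) ⟩
        δ l K.* x K.+ (e K.- δ l) K.* x
          K.≈⟨ K.+-congˡ (cancel-gap I) ⟩
        δ l K.* x K.+ signed l I K.* P I
          K.≈⟨ K.+-cong (coeff-scalar-* (δ l) (μ l) I) (K.reflexive (coeff-zeon _ I)) ⟨
        ⟨ scalar (δ l) * μ l ,ζ I ⟩ K.+ ⟨ flow l ,ζ I ⟩
          K.≈⟨ coeff-+ (scalar (δ l) * μ l) (flow l) I ⟨
        ⟨ scalar (δ l) * μ l + flow l ,ζ I ⟩
          K.∎
      where
      cancel-gap : ∀ I → (e K.- δ l) K.* ⟨ μ l ,ζ I ⟩ K.≈ signed l I K.* P I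
      cancel-gap I = K.begin
        (e K.- δ l) K.* ⟨ μ l ,ζ I ⟩                            K.≡⟨ ≡.cong (_ K.*_) (coeff-μ l l≢r I) ⟩
        (e K.- δ l) K.* (signed l I K.* gap⁻¹ l l≢r K.* P I)    K.≈⟨ K.*-assoc _ _ _ ⟨
        (e K.- δ l) K.* (signed l I K.* gap⁻¹ l l≢r) K.* P I    K.≈⟨ K.*-congʳ (K.x∙yz≈y∙xz _ _ _) ⟩
        signed l I K.* ((e K.- δ l) K.* gap⁻¹ l l≢r) K.* P I
          K.≈⟨ K.*-congʳ (K.trans (K.*-congˡ (gap⁻¹-inverse l l≢r)) (K.*-identityʳ _)) ⟩
        signed l I K.* P I                                      K.∎

    coeff-scalar-∅ : ∀ a {n} (I : Subset n) → ∣ I ∣ ≡ 0 → ⟨ scalar a ,ζ I ⟩ ≡ a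
    coeff-scalar-∅ a []            _ = ≡.refl
    coeff-scalar-∅ a (outside ∷ I) ∣I∣≡0 = coeff-scalar-∅ a I ∣I∣≡0

    coeff-scalar-≢∅ : ∀ a {n k} (I : Subset n) → ∣ I ∣ ≡ suc k → ⟨ scalar a ,ζ I ⟩ ≡ K.0#
    coeff-scalar-≢∅ a (outside ∷ I) ∣I∣≡1+k = coeff-scalar-≢∅ a I ∣I∣≡1+k
    coeff-scalar-≢∅ a (inside ∷ I)  _ = ≡.refl

    -- For `j` other than `r`, the inverse gap in the entry is exactly the factor that `j`
    -- contributes to `P I`. For `j = r`, the entry 1 has only its scalar coefficient, just as the
    -- only trail from `r` is empty. Hence all first steps share the weight `P I`.
    coeff-μ-∖ : ∀ I j → j ∈ I → ⟨ μ j ,ζ I ∖ j ⟩ K.≈ signed j (I ∖ j) K.* P I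
    coeff-μ-∖ I j j∈I with j Fin.≟ r
    ... | no j≢r = K.begin
      ⟨ zeon m _ ,ζ I ∖ j ⟩
        K.≡⟨ coeff-zeon _ (I ∖ j) ⟩
      signed j (I ∖ j) K.* gap⁻¹ j j≢r K.* P (I ∖ j)
        K.≈⟨ K.*-assoc _ _ _ ⟩
      signed j (I ∖ j) K.* (gap⁻¹ j j≢r K.* P (I ∖ j))
        K.≈⟨ K.*-congˡ (P-∈ I j j∈I j≢r) ⟨
      signed j (I ∖ j) K.* P I
        K.∎
    ... | yes ≡.refl with ∣ I ∖ r ∣ in ∣I-r∣≡
    ...   | zero = K.begin
      ⟨ 1# ,ζ I ∖ r ⟩
        K.≡⟨ coeff-scalar-∅ K.1# (I ∖ r) ∣I-r∣≡ ⟩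
      K.1#
        K.≈⟨ P-⁅r⁆ I j∈I (∣p∣≡0⇒p≡∅ {p = I ∖ r} ∣I-r∣≡) ⟨
      P I
        K.≈⟨ K.*-identityˡ _ ⟨
      K.1# K.* P I
        K.≈⟨ K.*-congʳ (K.trans (K.*-identityˡ _) (K.trans (K.×-congˡ N≡1) (K.×-homo-1 K.1#))) ⟨
      K.1# K.* (length (trails 0 r (I ∖ r)) K.· K.1#) K.* P I
        K.∎
      where
      N≡1 : length (trails 0 r (I ∖ r)) ≡ 1
      N≡1 = ≡.subst (λ k → length (trails k r (I ∖ r)) ≡ 1) ∣I-r∣≡ (#trails-r-∅ {I ∖ r} ∣I-r∣≡)
    ...   | suc k = K.begin
      ⟨ 1# ,ζ I ∖ r ⟩
        K.≡⟨ coeff-scalar-≢∅ K.1# (I ∖ r) ∣I-r∣≡ ⟩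
      K.0#
        K.≈⟨ K.zeroˡ _ ⟨
      K.0# K.* P I
        K.≈⟨ K.*-congʳ (K.trans (K.*-congˡ (K.×-congˡ N≡0)) (K.zeroʳ _)) ⟨
      sign (suc k) K.* (length (trails (suc k) r (I ∖ r)) K.· K.1#) K.* P I
        K.∎
      where
      N≡0 : length (trails (suc k) r (I ∖ r)) ≡ 0
      N≡0 = ≡.subst (λ k → length (trails k r (I ∖ r)) ≡ 0) ∣I-r∣≡ (#trails-r-suc {I = I ∖ r} ∣I-r∣≡)

    length-concat-tabulate : ∀ {n} {A : Set} (f : Fin n → List A) →
      length (concat (tabulate f)) K.· K.1# K.≈ K.sum λ j → length (f j) K.· K.1#
    length-concat-tabulate {zero}  f = K.refl
    length-concat-tabulate {suc n} f = K.trans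
      (K.trans (K.×-congˡ (length-++ (f zero))) (K.×-homo-+ K.1# (length (f zero)) _))
      (K.+-congˡ (length-concat-tabulate (f ∘ suc)))

    -- Trails on `I` are sorted by their first vertex. Entering it shrinks `I` by one element, and
    -- the change of `sign` produces the minus; on the empty set both sides vanish, since `l` is not
    -- `r`.
    Ψμ≈-flow : ∀ l → l ≢ r → (Ψ· μ) l ≈ - flow l
    Ψμ≈-flow l l≢r = ≈-bounded ((Ψ· μ) l) (- flow l) (bound-Ψ· μ l bound-μ) ℕ.≤-refl λ I → K.begin
      ⟨ (Ψ· μ) l ,ζ I ⟩
        K.≈⟨ coeff-sum (λ j → Ψ l j * μ j) I ⟩
      K.sum (λ j → ⟨ Ψ l j * μ j ,ζ I ⟩)
        K.≈⟨ K.sum-cong-≋ (λ j → coeff-Ψ* l j (μ j) I) ⟩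
      K.sum (λ j → if does (adj? l j ×-dec j ∈? I) then ⟨ μ j ,ζ I ∖ j ⟩ else K.0#)
        K.≈⟨ by-size I ∣ I ∣ ≡.refl ⟩
      K.- (signed l I K.* P I)
        K.≈⟨ K.-‿cong (K.reflexive (coeff-zeon _ I)) ⟨
      K.- ⟨ flow l ,ζ I ⟩
        K.≈⟨ coeff-neg (flow l) I ⟨
      ⟨ - flow l ,ζ I ⟩
        K.∎
      where
      term : Subset m → Fin m → K.Carrier
      term I j = if does (adj? l j ×-dec j ∈? I) then ⟨ μ j ,ζ I ∖ j ⟩ else K.0#

      term-∅ : ∀ I → ∣ I ∣ ≡ 0 → ∀ j → term I j K.≈ K.0#
      term-∅ I ∣I∣≡0 j with does (adj? l j) | j ∈? I
      ... | true  | yes j∈I = contradiction (≡.trans (≡.sym ∣I∣≡0) (∣p∣≡1+∣p-x∣ j∈I)) λ ()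
      ... | true  | no  _   = K.refl
      ... | false | _       = K.refl

      term-suc : ∀ I k → ∣ I ∣ ≡ suc k → ∀ j →
                 term I j K.≈ sign k K.* (length (trailsVia k l I j) K.· K.1#) K.* P I
      term-suc I k ∣I∣≡1+k j with does (adj? l j) | j ∈? I
      ... | false | _       = K.sym (K.trans (K.*-congʳ (K.zeroʳ _)) (K.zeroˡ _))
      ... | true  | no  _   = K.sym (K.trans (K.*-congʳ (K.zeroʳ _)) (K.zeroˡ _))
      ... | true  | yes j∈I = K.begin
        ⟨ μ j ,ζ I ∖ j ⟩
          K.≈⟨ coeff-μ-∖ I j j∈I ⟩
        sign ∣ I ∖ j ∣ K.* (length (trails ∣ I ∖ j ∣ j (I ∖ j)) K.· K.1#) K.* P I
          K.≡⟨ ≡.cong (λ k → sign k K.* (length (trails k j (I ∖ j)) K.· K.1#) K.* P I) (∣p-x∣≡k ∣I∣≡1+k j∈I) ⟩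
        sign k K.* (length (trails k j (I ∖ j)) K.· K.1#) K.* P I
          K.≡⟨ ≡.cong (λ n → sign k K.* (n K.· K.1#) K.* P I) (length-map (j List.∷_) (trails k j (I ∖ j))) ⟨
        sign k K.* (length (List.map (j List.∷_) (trails k j (I ∖ j))) K.· K.1#) K.* P I
          K.∎

      by-size : ∀ I k → ∣ I ∣ ≡ k → K.sum (term I) K.≈ K.- (signed l I K.* P I)
      by-size I zero ∣I∣≡0 = K.begin
        K.sum (term I)             K.≈⟨ K.sum-cong-≋ (term-∅ I ∣I∣≡0) ⟩
        K.sum (λ (_ : Fin m) → K.0#)  K.≈⟨ K.sum-replicate-zero m ⟩
        K.0#                       K.≈⟨ K.-0#≈0# ⟨
        K.- K.0#
          K.≈⟨ K.-‿cong (K.trans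
                 (K.*-congʳ (K.trans (K.*-congˡ (K.×-congˡ (#trails-∅ {I = I} l≢r ∣I∣≡0))) (K.zeroʳ _)))
                 (K.zeroˡ (P I))) ⟨
        K.- (signed l I K.* P I)   K.∎
      by-size I (suc k) ∣I∣≡1+k = K.begin
        K.sum (term I)
          K.≈⟨ K.sum-cong-≋ (term-suc I k ∣I∣≡1+k) ⟩
        K.sum (λ j → sign k K.* (length (trailsVia k l I j) K.· K.1#) K.* P I)
          K.≈⟨ K.*-distribʳ-sum (P I) (λ j → sign k K.* (length (trailsVia k l I j) K.· K.1#)) ⟨
        K.sum (λ j → sign k K.* (length (trailsVia k l I j) K.· K.1#)) K.* P I
          K.≈⟨ K.*-congʳ (K.*-distribˡ-sum (sign k) (λ j → length (trailsVia k l I j) K.· K.1#)) ⟨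
        sign k K.* K.sum (λ j → length (trailsVia k l I j) K.· K.1#) K.* P I
          K.≈⟨ K.*-congʳ (K.*-congˡ (length-concat-tabulate (trailsVia k l I))) ⟨
        sign k K.* (length (concat (tabulate (trailsVia k l I))) K.· K.1#) K.* P I
          K.≡⟨ ≡.cong (λ n → sign k K.* (n K.· K.1#) K.* P I) (#trails-suc {I = I} l≢r ∣I∣≡1+k) ⟨
        sign k K.* (#trails l I K.· K.1#) K.* P I
          K.≈⟨ K.-‿involutive _ ⟨
        K.- K.- (sign k K.* (#trails l I K.· K.1#) K.* P I)
          K.≈⟨ K.-‿cong (K.trans (K.-‿distribˡ-* _ (P I)) (K.*-congʳ (K.-‿distribˡ-* (sign k) _))) ⟩
        K.- (sign (suc k) K.* (#trails l I K.· K.1#) K.* P I)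
          K.≡⟨ ≡.cong (λ n → K.- (sign n K.* (#trails l I K.· K.1#) K.* P I)) ∣I∣≡1+k ⟨
        K.- (signed l I K.* P I)
          K.∎

    ev₀ : Zeon
    ev₀ = scalar e - (Ψ· μ) r

    ev₀≈e-Σ : ev₀ ≈ scalar e - sum (λ j → if does (adj? j r) then ζ ⁅ j ⁆ * μ j else 0#)
    ev₀≈e-Σ = Z.+-congˡ (Z.-‿cong (Z.sum-cong-≋ λ j → Ψ*-symm r j (μ j)))

    scalar-cong : ∀ {a b} → a K.≈ b → scalar a ≈ scalar b
    scalar-cong {a} {b} a≈b = ≈-bounded {b = 0} (scalar a) (scalar b) z≤n z≤n λ { [] → a≈b }

    μr≈1 : μ r ≈ 1#
    μr≈1 = Z.reflexive μ-r

    μ-row : ∀ l → scalar (δ l) * μ l - (Ψ· μ) l ≈ ev₀ * μ l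
    μ-row l = row (l Fin.≟ r)
      where
      row : Dec (l ≡ r) → scalar (δ l) * μ l - (Ψ· μ) l ≈ ev₀ * μ l
      row (yes ≡.refl) = Z.begin
        scalar (δ r) * μ r - (Ψ· μ) r    Z.≈⟨ Z.+-congʳ (Z.*-cong (scalar-cong δr≈e) μr≈1) ⟩
        scalar e * 1# - (Ψ· μ) r         Z.≈⟨ Z.+-congʳ (Z.*-identityʳ (scalar e)) ⟩
        ev₀                              Z.≈⟨ Z.*-identityʳ ev₀ ⟨
        ev₀ * 1#                         Z.≈⟨ Z.*-congˡ μr≈1 ⟨
        ev₀ * μ r                        Z.∎
      row (no l≢r) = Z.begin
        scalar (δ l) * μ l - (Ψ· μ) l
          Z.≈⟨ Z.+-congˡ (Z.trans (Z.-‿cong (Ψμ≈-flow l l≢r)) (Z.-‿involutive (flow l))) ⟩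
        scalar (δ l) * μ l + flow l
          Z.≈⟨ scalar-gap l l≢r ⟨
        scalar e * μ l
          Z.≈⟨ Z.trans (Z.+-congˡ Z.-0#≈0#) (Z.+-identityʳ _) ⟨
        scalar e * μ l - 0#
          Z.≈⟨ Z.+-congˡ (Z.-‿cong (multiple-*-μ l l≢r (bound-Ψ· μ r bound-μ) Ψμr-multiple)) ⟨
        scalar e * μ l - (Ψ· μ) r * μ l
          Z.≈⟨ Z.+-congˡ (Z.-‿distribˡ-* ((Ψ· μ) r) (μ l)) ⟩
        scalar e * μ l + - (Ψ· μ) r * μ l
          Z.≈⟨ Z.distribʳ (μ l) (scalar e) (- (Ψ· μ) r) ⟨
        ev₀ * μ l
          Z.∎

    μ-eigenvector : ∀ l → sum (λ j → Λ l j * μ j) ≈ ev₀ * μ l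
    μ-eigenvector l = Z.trans (Λ·≈ μ l) (μ-row l)

    μ-nilpotent : ∀ l → l ≢ r → InNilpotentIdeal m (μ l)
    -- Exponent 2 suffices, since ζ_r divides both factors of the square; the power ends in a factor
    -- `1#`, which is removed first.
    μ-nilpotent l l≢r = in-subalgebra , 2 , Z.trans (Z.*-congˡ (Z.*-identityʳ (μ l)))
      (multiple-*-μ l l≢r (bound-μ l) (μ-multiple l l≢r))
      where
      in-subalgebra : InSubalgebra m (μ l)
      in-subalgebra with l Fin.≟ r
      ... | yes _ = scalar∈ K.1#
      ... | no  _ = zeon∈ m _

    𝔠-μ : ∀ l → l ≢ r → 𝔠 (μ l) K.≈ K.0#
    𝔠-μ l l≢r = K.trans (K.reflexive (≡.sym (𝔠-coeff-∅ m (μ l)))) (μ-multiple l l≢r ∅ ∉⊥)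

    𝔠-Ψ· : ∀ v l → 𝔠 ((Ψ· v) l) K.≈ K.0#
    -- Vanishing below degree 0 is vacuous, so `Ψ· v` has no scalar part for any `v`.
    𝔠-Ψ· v l = VanishesBelow-Ψ· {k = 0} v l (λ _ _ ()) [] (s≤s z≤n)

    𝔠-ev₀ : 𝔠 ev₀ K.≈ e
    𝔠-ev₀ = K.trans (coeff-sub (scalar e) ((Ψ· μ) r) [])
      (K.trans (K.+-congˡ (K.trans (K.-‿cong (𝔠-Ψ· μ r)) K.-0#≈0#)) (K.+-identityʳ e))

    -- Comparison of an arbitrary eigenvector with `μ`.

    module Uniqueness (ev : Zeon) (ξ : Fin m → Zeon) (𝔠ev≈e : 𝔠 ev K.≈ e)
      (ξ-eigenvector : ∀ l → sum (λ j → Λ l j * ξ j) ≈ ev * ξ l) where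

      η : Fin m → Zeon
      η l = ξ l - ξ r * μ l

      ρ : Zeon
      ρ = ξ r * (ev₀ - ev)

      move : ∀ {a b c} x → a * x - b ≈ c * x → (a - c) * x ≈ b
      move {a} {b} {c} x eq = Z.begin
        (a - c) * x              Z.≈⟨ Z.distribʳ x a (- c) ⟩
        a * x + - c * x          Z.≈⟨ Z.+-congˡ (Z.-‿distribˡ-* c x) ⟨
        a * x - c * x            Z.≈⟨ Z.+-congˡ (Z.-‿cong eq) ⟨
        a * x - (a * x - b)      Z.≈⟨ Z.+-congˡ (Z.⁻¹-∙-comm (a * x) (- b)) ⟨
        a * x + (- (a * x) - - b)  Z.≈⟨ Z.+-assoc (a * x) (- (a * x)) (- - b) ⟨
        (a * x - a * x) - - b    Z.≈⟨ Z.+-cong (Z.-‿inverseʳ (a * x)) (Z.-‿involutive b) ⟩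
        0# + b                   Z.≈⟨ Z.+-identityˡ b ⟩
        b                        Z.∎

      -- The vectors `ξ` and `μ` satisfy eigenvector equations for possibly different eigenvalues;
      -- the discrepancy `ev₀ - ev` is collected in the single multiplier `ρ`.
      η-row : ∀ l → (scalar (δ l) - ev) * η l ≈ (Ψ· η) l - ρ * μ l
      η-row l = Z.begin
        D * (ξ l - ξ r * μ l)
          Z.≈⟨ Z.distribˡ D (ξ l) (- (ξ r * μ l)) ⟩
        D * ξ l + D * - (ξ r * μ l)
          Z.≈⟨ Z.+-cong Dξ (Z.trans (Z.sym (Z.-‿distribʳ-* D (ξ r * μ l))) (Z.-‿cong (Z.x∙yz≈y∙xz D (ξ r) (μ l)))) ⟩
        (Ψ· ξ) l - ξ r * (D * μ l)
          Z.≈⟨ Z.+-congˡ (Z.-‿cong (Z.*-congˡ Dμ)) ⟩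
        (Ψ· ξ) l - ξ r * ((Ψ· μ) l + (ev₀ - ev) * μ l)
          Z.≈⟨ Z.+-congˡ (Z.-‿cong (Z.trans (Z.distribˡ (ξ r) _ _) (Z.+-congˡ (Z.sym (Z.*-assoc (ξ r) _ (μ l)))))) ⟩
        (Ψ· ξ) l - (ξ r * (Ψ· μ) l + ρ * μ l)
          Z.≈⟨ Z.+-congˡ (Z.⁻¹-∙-comm _ _) ⟨
        (Ψ· ξ) l + (- (ξ r * (Ψ· μ) l) - ρ * μ l)
          Z.≈⟨ Z.+-assoc _ _ _ ⟨
        (Ψ· ξ) l - ξ r * (Ψ· μ) l - ρ * μ l
          Z.≈⟨ Z.+-congʳ (Ψ·-sub ξ (ξ r) μ l) ⟨
        (Ψ· η) l - ρ * μ l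
          Z.∎
        where
        D : Zeon
        D = scalar (δ l) - ev

        Dξ : D * ξ l ≈ (Ψ· ξ) l
        Dξ = move (ξ l) (Z.trans (Z.sym (Λ·≈ ξ l)) (ξ-eigenvector l))

        Dμ : D * μ l ≈ (Ψ· μ) l + (ev₀ - ev) * μ l
        Dμ = Z.begin
          (scalar (δ l) - ev) * μ l
            Z.≈⟨ Z.*-congʳ (Z.+-congʳ (Z.trans (Z.+-congˡ (Z.-‿inverseˡ ev₀)) (Z.+-identityʳ _))) ⟨
          (scalar (δ l) + (- ev₀ + ev₀) - ev) * μ l
            Z.≈⟨ Z.*-congʳ (Z.trans (Z.+-congʳ (Z.sym (Z.+-assoc _ (- ev₀) ev₀))) (Z.+-assoc _ ev₀ (- ev))) ⟩
          ((scalar (δ l) - ev₀) + (ev₀ - ev)) * μ l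
            Z.≈⟨ Z.distribʳ (μ l) _ _ ⟩
          (scalar (δ l) - ev₀) * μ l + (ev₀ - ev) * μ l
            Z.≈⟨ Z.+-congʳ (move (μ l) (μ-row l)) ⟩
          (Ψ· μ) l + (ev₀ - ev) * μ l
            Z.∎

      η-r : η r ≈ 0#
      η-r = Z.trans (Z.+-congˡ (Z.-‿cong (Z.trans (Z.*-congˡ μr≈1) (Z.*-identityʳ (ξ r))))) (Z.-‿inverseʳ (ξ r))

      -- With η_r = 0 and μ_r = 1, row `r` reads 0 = (Ψ η)_r - ρ. The discrepancy is thus of higher
      -- degree than `η` and cannot obstruct the induction on degrees.
      ρ≈Ψη : ρ ≈ (Ψ· η) r
      ρ≈Ψη = Z.begin
        ρ                                              Z.≈⟨ Z.+-identityʳ ρ ⟨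
        ρ + 0#                                         Z.≈⟨ Z.+-congˡ zero-row ⟨
        ρ + ((Ψ· η) r - ρ * μ r)                       Z.≈⟨ Z.+-congˡ (Z.+-congˡ (Z.-‿cong
                                                              (Z.trans (Z.*-congˡ μr≈1) (Z.*-identityʳ ρ)))) ⟩
        ρ + ((Ψ· η) r - ρ)                             Z.≈⟨ Z.+-comm ρ _ ⟩
        ((Ψ· η) r - ρ) + ρ                             Z.≈⟨ Z.+-assoc _ (- ρ) ρ ⟩
        (Ψ· η) r + (- ρ + ρ)                           Z.≈⟨ Z.trans (Z.+-congˡ (Z.-‿inverseˡ ρ)) (Z.+-identityʳ _) ⟩
        (Ψ· η) r                                       Z.∎
        where
        zero-row : (Ψ· η) r - ρ * μ r ≈ 0#
        zero-row = Z.trans (Z.sym (η-row r)) (Z.trans (Z.*-congˡ η-r) (Z.zeroʳ _))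

      η-vanishes : ∀ k l → VanishesBelow k (η l)
      η-vanishes zero    _ _ ()
      η-vanishes (suc k) l = vanishes (l Fin.≟ r)
        where
        Ψη-vanishes : ∀ i → VanishesBelow (suc k) ((Ψ· η) i)
        Ψη-vanishes i = VanishesBelow-Ψ· η i (η-vanishes k)

        ρ-vanishes : VanishesBelow (suc k) ρ
        ρ-vanishes I ∣I∣≤k = K.trans (ρ≈Ψη I) (Ψη-vanishes r I ∣I∣≤k)

        row-vanishes : VanishesBelow (suc k) ((scalar (δ l) - ev) * η l)
        row-vanishes I ∣I∣≤k = K.trans (η-row l I) (VanishesBelow-sub ((Ψ· η) l) (ρ * μ l) (Ψη-vanishes l)
          (λ J ∣J∣≤k → K.trans (Z.*-comm ρ (μ l) J) (VanishesBelow-* (μ l) ρ ρ-vanishes J ∣J∣≤k)) I ∣I∣≤k)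

        vanishes : Dec (l ≡ r) → VanishesBelow (suc k) (η l)
        vanishes (yes ≡.refl) I _ = K.trans (η-r I) (coeff-0# I)
        -- The scalar part of the coefficient is `δ l - e`, the negative of the gap, whence the sign
        -- of its inverse.
        vanishes (no l≢r) = VanishesBelow-suc (K.- gap⁻¹ l l≢r) (scalar (δ l) - ev) (η l) inverse
          (η-vanishes k l) row-vanishes
          where
          inverse : K.- gap⁻¹ l l≢r K.* 𝔠 (scalar (δ l) - ev) K.≈ K.1#
          inverse = K.begin
            K.- gap⁻¹ l l≢r K.* 𝔠 (scalar (δ l) - ev)
              K.≈⟨ K.*-congˡ (K.trans (coeff-sub (scalar (δ l)) ev []) (K.+-congˡ (K.-‿cong 𝔠ev≈e))) ⟩
            K.- gap⁻¹ l l≢r K.* (δ l K.- e)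
              K.≈⟨ K.-‿distribˡ-* _ _ ⟨
            K.- (gap⁻¹ l l≢r K.* (δ l K.- e))
              K.≈⟨ K.-‿distribʳ-* _ _ ⟩
            gap⁻¹ l l≢r K.* K.- (δ l K.- e)
              K.≈⟨ K.*-congˡ (K.trans (K.sym (K.⁻¹-∙-comm (δ l) (K.- e)))
                     (K.trans (K.+-congˡ (K.-‿involutive e)) (K.+-comm _ e))) ⟩
            gap⁻¹ l l≢r K.* (e K.- δ l)
              K.≈⟨ K.trans (K.*-comm _ _) (gap⁻¹-inverse l l≢r) ⟩
            K.1#
              K.∎

      η≈0 : ∀ l → η l ≈ 0#
      η≈0 l = ≈0-by-degree (η l) λ k → η-vanishes k l

      -- From `η` = 0, ξ_l = ξ_r μ_l with `μ l` nilpotent. Non-nullity of `ξ` is thereby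
      -- concentrated in the component at `r`.
      𝔠-ξ : ∀ l → l ≢ r → 𝔠 (ξ l) K.≈ K.0#
      𝔠-ξ l l≢r = K.begin
        𝔠 (ξ l)                          K.≈⟨ Z.x-y≈0⇒x≈y (ξ l) (ξ r * μ l) (η≈0 l) [] ⟩
        𝔠 (ξ r * μ l)                    K.≈⟨ 𝔠-* (ξ r) (μ l) ⟩
        𝔠 (ξ r) K.* 𝔠 (μ l)              K.≈⟨ K.trans (K.*-congˡ (𝔠-μ l l≢r)) (K.zeroʳ _) ⟩
        K.0#                             K.∎

      ev₀≈ev : ∀ a → a K.* 𝔠 (ξ r) K.≈ K.1# → ev₀ ≈ ev
      ev₀≈ev a a𝔠ξr≈1 = Z.x-y≈0⇒x≈y ev₀ ev (*-cancelˡ-0 a (ξ r) (ev₀ - ev) a𝔠ξr≈1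
        (Z.trans ρ≈Ψη (Z.trans (Z.sum-cong-≋ (λ j → Z.trans (Z.*-congˡ (η≈0 j)) (Z.zeroʳ (Ψ r j))))
          (Z.sum-replicate-zero m))))

-- The graph Laplacian over the complex numbers.

module LaplacianSpectrum {c ℓ₁ ℓ₂} (ℝ : RealNumbers c ℓ₁ ℓ₂) {m} (G : SimpleGraph m)
  (d : ℤ) (r : Fin m) (r-unique : SimpleGraph.UniqueVertexOfDegree G d r) where

  open SimpleGraph G
  open Complex ℝ
  open ZeonMatrices ℝ hiding (_≈_)
  open ZeonLaplacian ℝ G
  open Trails G r
  open ComplexRing ℝ
  open IntegersProperties ℝ
  open ZeonRing complexRing

  private
    module ℝ where
      open RealNumbers ℝ public
      open Algebra.Properties.Ring (CommutativeRing.ring commutativeRing) public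
    module ℂ+ where
      open CommutativeRing complexRing public
      open Algebra.Properties.Ring ring public
      open SumProperties +-commutativeMonoid public
      open Algebra.Properties.CommutativeMonoid.Sum +-commutativeMonoid public using (sum; sum-cong-≋)
      open Algebra.Properties.Monoid.Mult +-monoid public using () renaming (_×_ to _·_)
      open Relation.Binary.Reasoning.Setoid setoid public
    module Z = CommutativeRing zeonRing
    module ℂ* where
      open SumProperties (CommutativeRing.*-commutativeMonoid complexRing) public
      open Algebra.Properties.CommutativeMonoid.Sum (CommutativeRing.*-commutativeMonoid complexRing) public
        using (sum-cong-≋; sum-replicate-zero)

  gap⁻¹-inverse : ∀ j j≢r → (⟦ d ⟧ ℂ+.- ⟦ + deg j ⟧) *ℂ gap⁻¹ r-unique j j≢r ≈ℂ 1ℂ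
  gap⁻¹-inverse j j≢r = ℂ+.begin
    (⟦ d ⟧ ℂ+.- ⟦ + deg j ⟧) *ℂ gap⁻¹ r-unique j j≢r
      ℂ+.≈⟨ ℂ+.*-congʳ (ℝ.sym (fromℤ-sub d (deg j)) , ℝ.-‿inverseʳ ℝ.0#) ⟩
    ⟦ d ℤ.- + deg j ⟧ *ℂ gap⁻¹ r-unique j j≢r
      ℂ+.≈⟨ fromℝ-* _ _ ⟩
    fromℝ (Integers.fromℤ ℝ (d ℤ.- + deg j) ℝ.* Integers.inverse ℝ (d ℤ.- + deg j) (gap≢0 r-unique j j≢r))
      ℂ+.≈⟨ inverse-inverse (d ℤ.- + deg j) (gap≢0 r-unique j j≢r) , ℝ.refl ⟩
    1ℂ
      ℂ+.∎

  -- The factors are local to the definition of gap⁻¹-product and are named by unification.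
  gap⁻¹-product-factors : ∀ I → Σ[ t ∈ (Fin m → ℂ) ] gap⁻¹-product r-unique I ≡ productℂ t
  gap⁻¹-product-factors I = _ , ≡.refl

  factor : Subset m → Fin m → ℂ
  factor I = proj₁ (gap⁻¹-product-factors I)

  factor-∈ : ∀ I j → j ∈ I → (j≢r : j ≢ r) → factor I j ≡ gap⁻¹ r-unique j j≢r
  factor-∈ I j j∈I j≢r with j ∈? I | j Fin.≟ r
  ... | yes _   | no _    = ≡.refl
  ... | yes _   | yes j≡r = contradiction j≡r j≢r
  ... | no  j∉I | _       = contradiction j∈I j∉I

  factor-∉ : ∀ I j → j ∉ I → factor I j ≡ 1ℂ
  factor-∉ I j j∉I with j ∈? I | j Fin.≟ r
  ... | yes j∈I | _     = contradiction j∈I j∉I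
  ... | no  _   | yes _ = ≡.refl
  ... | no  _   | no  _ = ≡.refl

  factor-r : ∀ I → factor I r ≡ 1ℂ
  factor-r I with r ∈? I | r Fin.≟ r
  ... | yes _ | yes _   = ≡.refl
  ... | no  _ | yes _   = ≡.refl
  ... | _     | no  r≢r = contradiction ≡.refl r≢r

  factor-∖ : ∀ I j i → i ≢ j → factor I i ≡ factor (I ∖ j) i
  factor-∖ I j i i≢j = cases (i ∈? I) (i Fin.≟ r)
    where
    cases : Dec (i ∈ I) → Dec (i ≡ r) → factor I i ≡ factor (I ∖ j) i
    cases _         (yes ≡.refl) = ≡.trans (factor-r I) (≡.sym (factor-r (I ∖ j)))
    cases (yes i∈I) (no i≢r)     =
      ≡.trans (factor-∈ I i i∈I i≢r) (≡.sym (factor-∈ (I ∖ j) i (x∈p∧x≢y⇒x∈p-y i∈I i≢j) i≢r))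
    cases (no i∉I)  (no _)       =
      ≡.trans (factor-∉ I i i∉I) (≡.sym (factor-∉ (I ∖ j) i λ i∈ → i∉I (p─q⊆p I ⁅ j ⁆ i∈)))

  -- Deleting `j` turns its factor into 1 and leaves the others unchanged, so the multiplicative
  -- form of `sum-split` applies.
  gap⁻¹-product-∈ : ∀ I j → j ∈ I → (j≢r : j ≢ r) →
    gap⁻¹-product r-unique I ≈ℂ gap⁻¹ r-unique j j≢r *ℂ gap⁻¹-product r-unique (I ∖ j)
  gap⁻¹-product-∈ I j j∈I j≢r = ℂ+.trans
    (ℂ*.sum-split (factor I) (factor (I ∖ j)) j (ℂ+.reflexive (factor-∉ (I ∖ j) j (x∉p-x j I)))
      (λ i i≢j → ℂ+.reflexive (factor-∖ I j i i≢j)))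
    (ℂ+.*-congʳ (ℂ+.reflexive (factor-∈ I j j∈I j≢r)))

  gap⁻¹-product-⁅r⁆ : ∀ I → r ∈ I → I ∖ r ≡ ∅ → gap⁻¹-product r-unique I ≈ℂ 1ℂ
  gap⁻¹-product-⁅r⁆ I _ I-r≡∅ = ℂ+.trans
    (ℂ*.sum-cong-≋ {x = factor I} λ j → ℂ+.reflexive (cases j (j Fin.≟ r))) (ℂ*.sum-replicate-zero m)
    where
    cases : ∀ j → Dec (j ≡ r) → factor I j ≡ 1ℂ
    cases j (yes ≡.refl) = factor-r I
    cases j (no j≢r)     = ≡.trans (factor-∖ I r j j≢r)
      (factor-∉ (I ∖ r) j λ j∈ → ∉⊥ (≡.subst (j ∈_) I-r≡∅ j∈))

  open ZeonSpectrum complexRing G r (λ i → ⟦ + deg i ⟧) using (module SimpleEigenvalue)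
  open SimpleEigenvalue ⟦ d ⟧ (gap⁻¹ r-unique) gap⁻¹-inverse
    (ℂ+.reflexive (≡.cong ⟦_⟧ (proj₁ r-unique))) (gap⁻¹-product r-unique)
    gap⁻¹-product-⁅r⁆ gap⁻¹-product-∈ public

  ⟦⟧-neg : ∀ i → ⟦ ℤ.- i ⟧ ≈ℂ ℂ+.- ⟦ i ⟧
  ⟦⟧-neg i = fromℤ-neg i , ℝ.sym ℝ.-0#≈0#

  γ : Fin m → Subset m → ℤ
  γ l I = (-1ℤ ℤ.^ ∣ I ∣) ℤ.* + #trails l I

  ⟦n⟧≈n·1 : ∀ n → ⟦ + n ⟧ ≈ℂ n ℂ+.· 1ℂ
  ⟦n⟧≈n·1 zero    = ℂ+.refl
  ⟦n⟧≈n·1 (suc n) = ℂ+.trans (ℝ.refl , ℝ.sym (ℝ.+-identityʳ ℝ.0#)) (ℂ+.+-congˡ {1ℂ} (⟦n⟧≈n·1 n))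

  -- Reconciles the two forms of the sign: an integer power in `γ`, and repeated negation in the
  -- coefficients of `μ`.
  ⟦-1^k*n⟧ : ∀ k n → ⟦ (-1ℤ ℤ.^ k) ℤ.* + n ⟧ ≈ℂ sign k *ℂ (n ℂ+.· 1ℂ)
  ⟦-1^k*n⟧ zero n = ℂ+.trans (ℂ+.reflexive (≡.cong ⟦_⟧ (ℤ.*-identityˡ (+ n))))
    (ℂ+.trans (⟦n⟧≈n·1 n) (ℂ+.sym (ℂ+.*-identityˡ _)))
  ⟦-1^k*n⟧ (suc k) n = ℂ+.begin
    ⟦ (-1ℤ ℤ.* s) ℤ.* + n ⟧
      ℂ+.≡⟨ ≡.cong ⟦_⟧ (≡.trans (ℤ.*-assoc -1ℤ s (+ n)) (ℤ.-1*i≡-i (s ℤ.* + n))) ⟩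
    ⟦ ℤ.- (s ℤ.* + n) ⟧
      ℂ+.≈⟨ ⟦⟧-neg (s ℤ.* + n) ⟩
    ℂ+.- ⟦ s ℤ.* + n ⟧
      ℂ+.≈⟨ ℂ+.-‿cong (⟦-1^k*n⟧ k n) ⟩
    ℂ+.- (sign k *ℂ (n ℂ+.· 1ℂ))
      ℂ+.≈⟨ ℂ+.-‿distribˡ-* (sign k) _ ⟩
    sign (suc k) *ℂ (n ℂ+.· 1ℂ)
      ℂ+.∎
    where
    s : ℤ
    s = -1ℤ ℤ.^ k

  coeff-μ-γ : ∀ l (l≢r : l ≢ r) (I : Subset m) →
    ⟨ μ l ,ζ I ⟩ ≈ℂ ⟦ γ l I ⟧ *ℂ gap⁻¹ r-unique l l≢r *ℂ gap⁻¹-product r-unique I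
  coeff-μ-γ l l≢r I = ℂ+.trans (ℂ+.reflexive (coeff-μ l l≢r I))
    (ℂ+.*-congʳ (ℂ+.*-congʳ (ℂ+.sym (⟦-1^k*n⟧ ∣ I ∣ (#trails l I)))))

  -- Only the summand at `r` survives. Applied to `μ` it proves non-nullity; applied to another
  -- eigenvector it turns non-nullity into invertibility of `𝔠 (ξ r)`.
  𝔠-norm : ∀ (ξ : Fin m → Zeon) → (∀ l → l ≢ r → 𝔠 (ξ l) ≈ℂ 0ℂ) →
           𝔠 (sum λ i → conjugate (ξ i) * ξ i) ≈ℂ conj (𝔠 (ξ r)) *ℂ 𝔠 (ξ r)
  𝔠-norm ξ 𝔠ξ≈0 = ℂ+.begin
    𝔠 (sum λ i → conjugate (ξ i) * ξ i)
      ℂ+.≈⟨ coeff-sum (λ i → conjugate (ξ i) * ξ i) [] ⟩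
    ℂ+.sum (λ i → 𝔠 (conjugate (ξ i) * ξ i))
      ℂ+.≈⟨ ℂ+.sum-cong-≋ (λ i → 𝔠-* (conjugate (ξ i)) (ξ i)) ⟩
    ℂ+.sum (λ i → conj (𝔠 (ξ i)) *ℂ 𝔠 (ξ i))
      ℂ+.≈⟨ ℂ+.sum-single (λ i → conj (𝔠 (ξ i)) *ℂ 𝔠 (ξ i)) r
               (λ l l≢r → ℂ+.trans (ℂ+.*-congˡ (𝔠ξ≈0 l l≢r)) (ℂ+.zeroʳ _)) ⟩
    conj (𝔠 (ξ r)) *ℂ 𝔠 (ξ r)
      ℂ+.∎

  μ-NonNull : NonNull μ
  μ-NonNull = #-respˡ (ℂ+.sym (ℂ+.trans (𝔠-norm μ 𝔠-μ) norm-r)) 1#0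
    where
    norm-r : conj (𝔠 (μ r)) *ℂ 𝔠 (μ r) ≈ℂ 1ℂ
    norm-r rewrite μ-r = ℂ+.trans (ℂ+.*-identityʳ (conj 1ℂ)) (ℝ.refl , ℝ.-0#≈0#)

  ev₀-unique : ∀ ev → IsEigenvalue Λ ev → 𝔠 ev ≈ℂ ⟦ d ⟧ → ev₀ Z.≈ ev
  ev₀-unique ev (ξ , ξ-NonNull , Λξ≈evξ) 𝔠ev≈d = ev₀≈ev (proj₁ inverse) (proj₂ inverse)
    where
    open Uniqueness ev ξ 𝔠ev≈d Λξ≈evξ

    inverse : ∃[ a ] a *ℂ 𝔠 (ξ r) ≈ℂ 1ℂ
    inverse = conj*#0⇒invertible (𝔠 (ξ r)) (#-respˡ (𝔠-norm ξ 𝔠-ξ) ξ-NonNull)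

theorem3p12 :
    ∀ {c ℓ₁ ℓ₂} (ℝ : RealNumbers c ℓ₁ ℓ₂) {m : ℕ} (G : SimpleGraph m) →
    let open SimpleGraph G
        open Complex ℝ
        open ZeonMatrices ℝ
        open ZeonLaplacian ℝ G
    in
    (d : ℤ) (r : Fin m) (r-unique : UniqueVertexOfDegree d r) →
    ∃! _≈_ (λ ev → IsEigenvalue Λ ev × (𝔠 ev ≈ℂ ⟦ d ⟧))
    ×
    (∀ ev → IsEigenvalue Λ ev → 𝔠 ev ≈ℂ ⟦ d ⟧ →
      ∃[ μ ] IsEigenvector Λ ev μ
        × (μ r ≈ 1#)
        × (∀ i → i ≢ r → InNilpotentIdeal m (μ i))
        × (∀ l → (l≢r : l ≢ r) → (I : Subset m) →
            ∃[ γ ] ∃[ n ] HasExactly n (PathOrPWICOn l r I)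
              × ((-1ℤ ℤ.^ ∣ I ∣) ℤ.* γ ≡ + n)
              × (⟨ μ l ,ζ I ⟩ ≈ℂ ⟦ γ ⟧ *ℂ gap⁻¹ r-unique l l≢r *ℂ gap⁻¹-product r-unique I))
        -- The sign is forced by row r of Λ μ = ev μ, in which Λ = Δ - Ψ and μ r = 1.
        × (ev ≈ scalar ⟦ d ⟧ - sum (λ j → if does (adj? j r) then ζ ⁅ j ⁆ * μ j else 0#)))
theorem3p12 ℝ {m} G d r r-unique =
    (ev₀ , ((μ , μ-NonNull , μ-eigenvector) , 𝔠-ev₀)
         , λ {ev} (ev-eigenvalue , 𝔠ev≈d) → ev₀-unique ev ev-eigenvalue 𝔠ev≈d)
  , λ ev ev-eigenvalue 𝔠ev≈d →
      let ev₀≈ev = ev₀-unique ev ev-eigenvalue 𝔠ev≈d in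
        μ
      , (μ-NonNull , λ i → Z.trans (μ-eigenvector i) (Z.*-congʳ {μ i} ev₀≈ev))
      , μr≈1
      , μ-nilpotent
      , (λ l l≢r I → γ l I , #trails l I , HasExactly-#trails l≢r I
          , -1^k*[-1^k*i]≡i ∣ I ∣ (+ #trails l I) , coeff-μ-γ l l≢r I)
      , Z.trans (Z.sym ev₀≈ev) ev₀≈e-Σ
  where
  open LaplacianSpectrum ℝ G d r r-unique
  open Trails G r using (#trails; HasExactly-#trails)
  module Z = CommutativeRing (ZeonRing.zeonRing (ComplexRing.complexRing ℝ))
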